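{- Let $L\in\mathbb R^{n\times d}$ be a rank $k$ matrix and let $p\ge1$. Then there is $s=O(k\log\log k)$ and a decomposition $L=UV^\top$ into an $n\times s$ matrix $U$ and an $s\times d$ matrix $V^\top$ such that (1) $\|Ue_i\|_p\le1$ for each $i\in[s]$, and (2) $\|V^\top e_j\|_2\le O(1)\,\|Le_j\|_p$ for each $j\in[d]$.
   Context: $e_i$ denotes the $i$-th standard basis vector of the appropriate dimension, so $Me_j$ is the $j$-th column of $M$. $O(\cdot)$ hides absolute constants; $\log\log k$ is read as at least $1$. -}

module Defs where

open import Algebra.Bundles using (CommutativeRing)
import Algebra.Construct.NaturalChoice.Max as Max
import Algebra.Properties.Ring as RingProperties
import Algebra.Properties.Semiring.Exp as Exp
import Algebra.Properties.Semiring.Mult as Mult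
import Algebra.Properties.Semiring.Sum as Sum
open import Data.Empty using (⊥-elim)
open import Data.Fin.Base using (Fin)
open import Data.Nat.Base as ℕ using (ℕ; zero; suc; z≤n; s≤s)
open import Data.Nat.Logarithm using (⌊log₂_⌋)
import Data.Nat.Properties as ℕ
open import Data.Product.Base using (Σ; ∃; ∃-syntax; _×_; _,_; proj₁; proj₂)
open import Data.Sum.Base using (inj₁; inj₂)
open import Data.Vec.Functional using (Vector)
open import Function.Bundles using (_⇔_)
open import Level using (Level) renaming (suc to lsuc)
open import Relation.Binary.Bundles using (DecTotalOrder)
open import Relation.Binary.Core using (Rel)
open import Relation.Binary.Structures using (IsDecTotalOrder)
import Relation.Binary.Construct.NonStrictToStrict as NonStrictToStrict
import Relation.Binary.Properties.DecTotalOrder as DecTotalOrderProperties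
open import Relation.Nullary.Decidable.Core using (yes; no)
open import Relation.Nullary.Negation.Core using (¬_)
open import Relation.Unary using (Pred)

-- The library has no classical real numbers, so ℝ is given by its
-- categorical axiomatisation: a Dedekind-complete (classically) ordered
-- field.  A supremum is required to be approximated from inside the set;
-- classically this is the same as being the least upper bound.
record CompleteOrderedField (ℓ : Level) : Set (lsuc ℓ) where
  infix  4 _≤_
  infix  8 _⁻¹
  field
    commutativeRing : CommutativeRing ℓ ℓ

  open CommutativeRing commutativeRing public

  field
    _≤_             : Rel Carrier ℓ
    isDecTotalOrder : IsDecTotalOrder _≈_ _≤_
    -- The value at 0# is unspecified.
    _⁻¹             : Carrier → Carrier
    ⁻¹-inverseʳ     : ∀ {x} → ¬ (x ≈ 0#) → x * x ⁻¹ ≈ 1#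
    0≉1             : ¬ (0# ≈ 1#)
    +-monoʳ-≤       : ∀ {x y} z → x ≤ y → x + z ≤ y + z
    *-nonNeg        : ∀ {x y} → 0# ≤ x → 0# ≤ y → 0# ≤ x * y

  open NonStrictToStrict _≈_ _≤_ public using (_<_)

  UpperBound : Pred Carrier ℓ → Pred Carrier ℓ
  UpperBound P b = ∀ {x} → P x → x ≤ b

  IsSupremum : Pred Carrier ℓ → Pred Carrier ℓ
  IsSupremum P s = UpperBound P s × (∀ {t} → t < s → ∃[ x ] P x × t < x)

  field
    complete : (P : Pred Carrier ℓ) → ∃ P → ∃ (UpperBound P) → ∃ (IsSupremum P)

  decTotalOrder : DecTotalOrder ℓ ℓ ℓ
  decTotalOrder = record { isDecTotalOrder = isDecTotalOrder }

module OrderedFieldProperties {ℓ} (ℝ : CompleteOrderedField ℓ) where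
  open CompleteOrderedField ℝ
  open RingProperties ring using (-‿distribˡ-*; -‿distribʳ-*; -‿involutive)
  open Exp semiring public using (_^_; ^-homo-*; ^-assocʳ; ^-congʳ)
  open Mult semiring using (×-homo-+; ×1-homo-*) renaming (_×_ to _×ᴺ_)
  open DecTotalOrder decTotalOrder public
    using (_≤?_; _≟_; total; antisym; ≤-respˡ-≈; ≤-respʳ-≈; totalOrder; poset)
    renaming (refl to ≤-refl; trans to ≤-trans; reflexive to ≤-reflexive)
  open DecTotalOrderProperties decTotalOrder public using (≰⇒>; <⇒≱; ≰⇒≥)

  fromℕ : ℕ → Carrier
  fromℕ n = n ×ᴺ 1#

  +-cancelʳ-≤ : ∀ {x y} z → x + z ≤ y + z → x ≤ y
  +-cancelʳ-≤ {x} {y} z le =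
    ≤-respˡ-≈ (lem x) (≤-respʳ-≈ (lem y) (+-monoʳ-≤ (- z) le))
    where
    lem : ∀ w → (w + z) + - z ≈ w
    lem w = trans (+-assoc w z (- z)) (trans (+-congˡ (-‿inverseʳ z)) (+-identityʳ w))

  +-monoˡ-≤ : ∀ {x y} z → x ≤ y → z + x ≤ z + y
  +-monoˡ-≤ {x} {y} z le = ≤-respˡ-≈ (+-comm x z) (≤-respʳ-≈ (+-comm y z) (+-monoʳ-≤ z le))

  x≤y⇒0≤y-x : ∀ {x y} → x ≤ y → 0# ≤ y - x
  x≤y⇒0≤y-x {x} le = ≤-respˡ-≈ (-‿inverseʳ x) (+-monoʳ-≤ (- x) le)

  0≤y-x⇒x≤y : ∀ {x y} → 0# ≤ y - x → x ≤ y
  0≤y-x⇒x≤y {x} le = +-cancelʳ-≤ (- x) (≤-respˡ-≈ (sym (-‿inverseʳ x)) le)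

  0≤1 : 0# ≤ 1#
  0≤1 with total 0# 1#
  ... | inj₁ le = le
  ... | inj₂ ge = ≤-respʳ-≈ sq (*-nonNeg 0≤-1 0≤-1)
    where
    0≤-1 : 0# ≤ - 1#
    0≤-1 = ≤-respʳ-≈ (+-identityˡ (- 1#)) (x≤y⇒0≤y-x ge)
    sq : - 1# * - 1# ≈ 1#
    sq = trans (sym (-‿distribˡ-* 1# (- 1#)))
        (trans (-‿cong (*-identityˡ (- 1#))) (-‿involutive 1#))

  *-monoʳ-≤ : ∀ {x y z} → 0# ≤ z → x ≤ y → x * z ≤ y * z
  *-monoʳ-≤ {x} {y} {z} 0≤z le = 0≤y-x⇒x≤y
    (≤-respʳ-≈ (trans (distribʳ z y (- x)) (+-congˡ (sym (-‿distribˡ-* x z))))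
      (*-nonNeg (x≤y⇒0≤y-x le) 0≤z))

  *-monoˡ-≤ : ∀ {x y z} → 0# ≤ z → x ≤ y → z * x ≤ z * y
  *-monoˡ-≤ {x} {y} {z} 0≤z le =
    ≤-respˡ-≈ (*-comm x z) (≤-respʳ-≈ (*-comm y z) (*-monoʳ-≤ 0≤z le))

  *-mono-≤ : ∀ {x y u v} → 0# ≤ x → 0# ≤ v → x ≤ y → u ≤ v → x * u ≤ y * v
  *-mono-≤ 0≤x 0≤v x≤y u≤v = ≤-trans (*-monoˡ-≤ 0≤x u≤v) (*-monoʳ-≤ 0≤v x≤y)

  x*y≈0⇒y≈0 : ∀ {x y} → ¬ (x ≈ 0#) → x * y ≈ 0# → y ≈ 0#
  x*y≈0⇒y≈0 {x} {y} x≉0 xy≈0 =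
    trans (sym (*-identityˡ y))
    (trans (*-congʳ (trans (sym (⁻¹-inverseʳ x≉0)) (*-comm x (x ⁻¹))))
    (trans (*-assoc (x ⁻¹) x y) (trans (*-congˡ xy≈0) (zeroʳ (x ⁻¹)))))

  ≰0⇒≉0 : ∀ {x} → ¬ (x ≤ 0#) → ¬ (x ≈ 0#)
  ≰0⇒≉0 x≰0 x≈0 = x≰0 (≤-reflexive x≈0)

  *-cancelʳ-≤ : ∀ {x y z} → ¬ (z ≤ 0#) → x * z ≤ y * z → x ≤ y
  *-cancelʳ-≤ {x} {y} {z} z≰0 le with x ≤? y
  ... | yes x≤y = x≤y
  ... | no  x≰y = ⊥-elim (x≰y (≤-reflexive (sym y≈x)))
    where
    eq : x * z ≈ y * z
    eq = antisym le (*-monoʳ-≤ (≰⇒≥ z≰0) (≰⇒≥ x≰y))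
    z*[y-x]≈0 : z * (y - x) ≈ 0#
    z*[y-x]≈0 = trans (*-comm z (y - x))
      (trans (distribʳ z y (- x))
      (trans (+-cong (sym eq) (sym (-‿distribˡ-* x z))) (-‿inverseʳ (x * z))))
    y≈x : y ≈ x
    y≈x = trans (sym (+-identityʳ y)) (trans (+-congˡ (sym (-‿inverseˡ x)))
      (trans (sym (+-assoc y (- x) x))
      (trans (+-congʳ (x*y≈0⇒y≈0 (≰0⇒≉0 z≰0) z*[y-x]≈0)) (+-identityˡ x))))

  *-pos : ∀ {x y} → ¬ (x ≤ 0#) → ¬ (y ≤ 0#) → ¬ (x * y ≤ 0#)
  *-pos x≰0 y≰0 xy≤0 = x≰0 (*-cancelʳ-≤ y≰0 (≤-respʳ-≈ (sym (zeroˡ _)) xy≤0))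

  1≰0 : ¬ (1# ≤ 0#)
  1≰0 1≤0 = 0≉1 (antisym 0≤1 1≤0)

  ^-nonNeg : ∀ {x} n → 0# ≤ x → 0# ≤ x ^ n
  ^-nonNeg zero    0≤x = 0≤1
  ^-nonNeg (suc n) 0≤x = *-nonNeg 0≤x (^-nonNeg n 0≤x)

  ^-pos : ∀ {x} n → ¬ (x ≤ 0#) → ¬ (x ^ n ≤ 0#)
  ^-pos zero    x≰0 = 1≰0
  ^-pos (suc n) x≰0 = *-pos x≰0 (^-pos n x≰0)

  1≤^ : ∀ {x} n → 1# ≤ x → 1# ≤ x ^ n
  1≤^ zero    1≤x = ≤-refl
  1≤^ (suc n) 1≤x = ≤-respˡ-≈ (*-identityˡ 1#)
    (*-mono-≤ 0≤1 (^-nonNeg n (≤-trans 0≤1 1≤x)) 1≤x (1≤^ n 1≤x))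

  ^-monoʳ-≤ : ∀ {x m n} → 1# ≤ x → m ℕ.≤ n → x ^ m ≤ x ^ n
  ^-monoʳ-≤ {n = n} 1≤x z≤n = 1≤^ n 1≤x
  ^-monoʳ-≤ 1≤x (s≤s m≤n) = *-monoˡ-≤ (≤-trans 0≤1 1≤x) (^-monoʳ-≤ 1≤x m≤n)

  ^-monoˡ-≤ : ∀ {x y} n → 0# ≤ x → x ≤ y → x ^ n ≤ y ^ n
  ^-monoˡ-≤ zero    0≤x x≤y = ≤-refl
  ^-monoˡ-≤ (suc n) 0≤x x≤y =
    *-mono-≤ 0≤x (^-nonNeg n (≤-trans 0≤x x≤y)) x≤y (^-monoˡ-≤ n 0≤x x≤y)

  ^-cancelˡ-≤ : ∀ {x y} n → 0# ≤ x → 0# ≤ y → x ^ suc n ≤ y ^ suc n → x ≤ y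
  ^-cancelˡ-≤ {x} {y} n 0≤x 0≤y le with x ≤? y
  ... | yes x≤y = x≤y
  ... | no  x≰y = *-cancelʳ-≤ (^-pos n (λ x≤0 → x≰y (≤-trans x≤0 0≤y)))
    (≤-trans le (*-monoˡ-≤ 0≤y (^-monoˡ-≤ n 0≤y (≰⇒≥ x≰y))))

  0≤fromℕ : ∀ n → 0# ≤ fromℕ n
  0≤fromℕ zero    = ≤-refl
  0≤fromℕ (suc n) =
    ≤-trans 0≤1 (≤-respˡ-≈ (+-identityʳ 1#) (+-monoˡ-≤ 1# (0≤fromℕ n)))

  fromℕ-cancel-≤ : ∀ m n → fromℕ m ≤ fromℕ n → m ℕ.≤ n
  fromℕ-cancel-≤ zero    n       le = z≤n
  fromℕ-cancel-≤ (suc m) zero    le = ⊥-elim (1≰0 (≤-trans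
    (≤-respˡ-≈ (+-identityʳ 1#) (+-monoˡ-≤ 1# (0≤fromℕ m))) le))
  fromℕ-cancel-≤ (suc m) (suc n) le = s≤s (fromℕ-cancel-≤ m n
    (+-cancelʳ-≤ 1# (≤-respˡ-≈ (+-comm 1# _) (≤-respʳ-≈ (+-comm 1# _) le))))

  archimedean : ∀ a → ∃[ N ] a ≤ fromℕ N
  archimedean a with a ≤? 0#
  ... | yes a≤0 = 0 , a≤0
  ... | no  a≰0 = N+1 , a≤N+1
    where
    P : Pred Carrier _
    P x = x ≤ a × ∃[ N ] x ≤ fromℕ N
    sup : ∃ (IsSupremum P)
    sup = complete P (0# , ≰⇒≥ a≰0 , 0 , ≤-refl) (a , proj₁)
    s = proj₁ sup
    s-1<s : s - 1# < s
    s-1<s = ≰⇒> λ s≤s-1 → 1≰0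
      (+-cancelʳ-≤ (s - 1#) (≤-respˡ-≈ s≈ (≤-respʳ-≈ (sym (+-identityˡ _)) s≤s-1)))
      where
      s≈ : s ≈ 1# + (s - 1#)
      s≈ = sym (trans (+-comm 1# (s - 1#)) (trans (+-assoc s (- 1#) 1#)
        (trans (+-congˡ (-‿inverseˡ 1#)) (+-identityʳ s))))
    near : ∃[ x ] P x × (s - 1#) < x
    near = proj₂ (proj₂ sup) s-1<s
    N+1 : ℕ
    N+1 = suc (proj₁ (proj₂ (proj₁ (proj₂ near))))
    x≤N : proj₁ near ≤ fromℕ (proj₁ (proj₂ (proj₁ (proj₂ near))))
    x≤N = proj₂ (proj₂ (proj₁ (proj₂ near)))
    a≤N+1 : a ≤ fromℕ N+1
    a≤N+1 with a ≤? fromℕ N+1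
    ... | yes le = le
    ... | no  ≰  = ⊥-elim (<⇒≱ (proj₂ (proj₂ near)) (≤-trans x≤N N≤s-1))
      where
      N+1≤s : fromℕ N+1 ≤ s
      N+1≤s = proj₁ (proj₂ sup) (≰⇒≥ ≰ , N+1 , ≤-refl)
      lem : ∀ w → (1# + w) - 1# ≈ w
      lem w = trans (+-congʳ (+-comm 1# w)) (trans (+-assoc w 1# (- 1#))
        (trans (+-congˡ (-‿inverseʳ 1#)) (+-identityʳ w)))
      N≤s-1 : fromℕ (proj₁ (proj₂ (proj₁ (proj₂ near)))) ≤ s - 1#
      N≤s-1 = ≤-respˡ-≈ (lem _) (+-monoʳ-≤ (- 1#) N+1≤s)

  1≤x⁻¹ : ∀ {x} → ¬ (x ≤ 0#) → ¬ (1# ≤ x) → 1# ≤ x ⁻¹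
  1≤x⁻¹ {x} x≰0 1≰x = *-cancelʳ-≤ x≰0
    (≤-respˡ-≈ (sym (*-identityˡ x))
    (≤-respʳ-≈ (sym (trans (*-comm (x ⁻¹) x) (⁻¹-inverseʳ (≰0⇒≉0 x≰0)))) (≰⇒≥ 1≰x)))

  -- For x ≥ 1 this says 0 ≤ y ≤ x^q for some rational q = (i − j) / (1 + n)
  -- with q ≤ a, written without negative exponents or roots.
  BelowPower : (x a : Carrier) → Pred Carrier ℓ
  BelowPower x a y = 0# ≤ y × ∃[ n ] ∃[ i ] ∃[ j ]
    (fromℕ i ≤ fromℕ (suc n) * a + fromℕ j × y ^ suc n * x ^ j ≤ x ^ i)

  belowPower-inhabited : ∀ {x} a → 1# ≤ x → ∃ (BelowPower x a)
  belowPower-inhabited {x} a 1≤x with archimedean (- a)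
  ... | j , -a≤j = 0# , ≤-refl , 0 , 0 , j ,
    ≤-respʳ-≈ (+-congʳ (sym (trans (*-congʳ (+-identityʳ 1#)) (*-identityˡ a))))
      (≤-respˡ-≈ (-‿inverseʳ a) (+-monoˡ-≤ a -a≤j)) ,
    ≤-respˡ-≈ (sym (trans (*-congʳ (zeroˡ 1#)) (zeroˡ (x ^ j)))) 0≤1

  belowPower-bound : ∀ {x a} N → 1# ≤ x → a ≤ fromℕ N → UpperBound (BelowPower x a) (x ^ N)
  belowPower-bound {x} {a} N 1≤x a≤N {y} (0≤y , n , i , j , i≤ , y≤) =
    ^-cancelˡ-≤ n 0≤y (^-nonNeg N (≤-trans 0≤1 1≤x))
      (*-cancelʳ-≤ (^-pos j (λ x≤0 → 1≰0 (≤-trans 1≤x x≤0)))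
        (≤-trans y≤ (≤-respʳ-≈ eq (^-monoʳ-≤ 1≤x i≤ᴺ))))
    where
    k = suc n ℕ.* N ℕ.+ j
    i≤ᴺ : i ℕ.≤ k
    i≤ᴺ = fromℕ-cancel-≤ i k (≤-respʳ-≈
      (sym (trans (×-homo-+ 1# (suc n ℕ.* N) j) (+-congʳ (×1-homo-* (suc n) N))))
      (≤-trans i≤ (+-monoʳ-≤ (fromℕ j) (*-monoˡ-≤ (0≤fromℕ (suc n)) a≤N))))
    eq : x ^ k ≈ (x ^ N) ^ suc n * x ^ j
    eq = trans (^-homo-* x (suc n ℕ.* N) j)
      (*-congʳ (trans (^-congʳ x (ℕ.*-comm (suc n) N)) (sym (^-assocʳ x N (suc n)))))

module RealLinearAlgebra {ℓ} (ℝ : CompleteOrderedField ℓ) where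
  open CompleteOrderedField ℝ public
  open OrderedFieldProperties ℝ using
    (_≤?_; totalOrder; BelowPower; belowPower-inhabited; belowPower-bound; archimedean; 1≤x⁻¹)
  open Sum semiring public using (sum)
  open Max totalOrder public using (_⊔_)

  infixr 8 _^ʳ_
  infixl 7 _·_

  power≥1 : (x a : Carrier) → 1# ≤ x → Carrier
  power≥1 x a 1≤x = proj₁ (complete (BelowPower x a) (belowPower-inhabited a 1≤x)
    (let N , a≤N = archimedean a in _ , belowPower-bound N 1≤x a≤N))

  -- Real powers: x ^ʳ a is the supremum of the rational powers x^q with
  -- q ≤ a when x ≥ 1, and 1 / (1/x)^a when 0 < x < 1.  The value is 0# for
  -- x ≤ 0; below it is only used for x ≥ 0 and a > 0.
  _^ʳ_ : Carrier → Carrier → Carrier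
  x ^ʳ a with 1# ≤? x
  ... | yes 1≤x = power≥1 x a 1≤x
  ... | no  1≰x with x ≤? 0#
  ...   | yes _   = 0#
  ...   | no  x≰0 = power≥1 (x ⁻¹) a (1≤x⁻¹ x≰0 1≰x) ⁻¹

  ∣_∣ : Carrier → Carrier
  ∣ x ∣ = x ⊔ (- x)

  2# : Carrier
  2# = 1# + 1#

  ‖_‖[_] : ∀ {n} → Vector Carrier n → Carrier → Carrier
  ‖ v ‖[ p ] = sum (λ i → ∣ v i ∣ ^ʳ p) ^ʳ (p ⁻¹)

  -- Rows first: M i j is the entry in row i and column j.
  Matrix : ℕ → ℕ → Set ℓ
  Matrix m n = Vector (Vector Carrier n) m

  column : ∀ {m n} → Matrix m n → Fin n → Vector Carrier m
  column M j = λ i → M i j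

  _·_ : ∀ {m n o} → Matrix m n → Matrix n o → Matrix m o
  (M · N) i j = sum λ l → M i l * N l j

  _≈ᴹ_ : ∀ {m n} → Matrix m n → Matrix m n → Set ℓ
  M ≈ᴹ N = ∀ i j → M i j ≈ N i j

  _·ᵛ_ : ∀ {m n} → Matrix m n → Vector Carrier n → Vector Carrier m
  (M ·ᵛ x) i = sum λ j → M i j * x j

  _∈ColumnSpace_ : ∀ {m n} → Vector Carrier m → Matrix m n → Set ℓ
  y ∈ColumnSpace M = ∃[ x ] (∀ i → y i ≈ (M ·ᵛ x) i)

  LinearlyIndependentColumns : ∀ {m n} → Matrix m n → Set ℓ
  LinearlyIndependentColumns M =
    ∀ x → (∀ i → (M ·ᵛ x) i ≈ 0#) → ∀ j → x j ≈ 0#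

  -- The column space of M has a basis of k vectors, the columns of B.
  HasRank : ∀ {m n} → Matrix m n → ℕ → Set ℓ
  HasRank {m} M k = Σ (Matrix m k) λ B →
    LinearlyIndependentColumns B × (∀ y → (y ∈ColumnSpace M) ⇔ (y ∈ColumnSpace B))

-- log log k, read as at least 1.  The base and the rounding only affect the
-- constant in O(k log log k); ⌊log₂ ⌊log₂ k⌋⌋ = ⌊log₂ log₂ k⌋ for k ≥ 2.
loglog : ℕ → ℕ
loglog k = 1 ℕ.⊔ ⌊log₂ ⌊log₂ k ⌋ ⌋

{-# OPTIONS --safe #-}
-- After scaling every column of L to p-norm 1, choose m ≤ k columns σ that
-- span them all and take the coordinates c of the columns over σ.  Among all
-- multisets S of 2m columns let S maximise det M, where M = I + ∑ c cᵀ over S.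
-- Exchanging a column of leverage at most 1/2 (one exists since the leverages
-- sum to at most m) for column j shows cⱼᵀ M⁻¹ cⱼ ≤ 1.  This number is the
-- squared 2-norm of the coefficients cⱼᵀ M⁻¹ y, for y in σ ∪ S, that express
-- column j through the 3m columns of σ ∪ S.  So s ≤ 3k, without the log log k
-- factor.  Determinants are avoided: the inverse form and det M are updated one
-- vector at a time, and the order of the vectors turns out not to matter.
module Submission where

open import Defs
import Algebra.Construct.NaturalChoice.Base as NaturalChoice
import Algebra.Construct.NaturalChoice.Max as Max
import Algebra.Properties.CommutativeSemigroup as CommutativeSemigroupProperties
import Algebra.Properties.CommutativeSemiring.Exp as CommutativeExp
import Algebra.Properties.Ring as RingProperties
import Algebra.Properties.Semiring.Mult as Mult
import Algebra.Properties.Semiring.Sum as Sum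
import Algebra.Solver.Ring.NaturalCoefficients.Default as Solver
open import Data.Empty using (⊥-elim)
open import Data.Fin.Base using (Fin; zero; suc)
import Data.Fin.Properties as Fin
open import Data.List.Base using (List; []; _∷_; length; _++_)
open import Data.List.Membership.Propositional using (_∈_; find)
open import Data.List.Membership.Propositional.Properties using (∈-∃++)
open import Data.List.Relation.Binary.Permutation.Propositional as ↭ using (_↭_; prep; swap; ↭-reflexive)
open import Data.List.Relation.Binary.Permutation.Propositional.Properties using (shift; ↭-length)
open import Data.List.Relation.Unary.All as All using (All; []; _∷_)
open import Data.List.Relation.Unary.All.Properties using (¬Any⇒All¬)
open import Data.List.Relation.Unary.Any using (any?)
open import Data.Nat.Base as ℕ using (ℕ; zero; suc; z≤n; s≤s)
open import Data.Nat.Logarithm using (⌊log₂_⌋)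
import Data.Nat.Properties as ℕ
open import Data.Product.Base using (Σ; ∃-syntax; _×_; _,_; proj₁; proj₂)
open import Data.Sum.Base using (inj₁; inj₂)
open import Data.Vec.Functional using (Vector)
open import Function.Bundles using (Equivalence)
open import Level using (Level)
open import Relation.Binary.PropositionalEquality.Core as ≡ using (_≡_)
import Relation.Binary.Reasoning.PartialOrder as PartialOrderReasoning
open import Relation.Nullary.Decidable using (yes; no; ¬?; decidable-stable)
open import Relation.Nullary.Negation.Core using (¬_)

-- Every column of `U` is a normalised column of `L`, so (1) is immediate and the difficulty lies in
-- (2). The size 2m is chosen because 2m + 1 vectors of total leverage at most m must include one of
-- leverage h ≤ 1/2. Removing it turns h into h / (1 - h) ≤ 1 and divides det M by at most 2,
-- whereas adding column j multiplied det M by 1 + cⱼᵀ M⁻¹ cⱼ; maximality forces this factor to be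
-- at most 2 as well. The summand I of M, contributed by σ, keeps M invertible for every S. The
-- linear algebra rests on one identity, M⁻¹ M = I, tested on functionals (`Reproduced`). The rest
-- of the work is analytic: a real power is a supremum of rational powers, so monotonicity,
-- multiplicativity and inversion have to be derived from completeness and the Archimedean property.

-- Ordered-field arithmetic, limiting arguments and roots.

module OrderedFieldLemmas {ℓ : Level} (ℝ : CompleteOrderedField ℓ) where
  open CompleteOrderedField ℝ
  open OrderedFieldProperties ℝ
  open Mult semiring using (×-homo-+; ×1-homo-*)
  open CommutativeExp commutativeSemiring public using (^-distrib-*; ^-congˡ)
  open Solver commutativeSemiring public using (solve; _:+_; _:*_; _:=_)
  module ≤-Reasoning = PartialOrderReasoning poset
  open ≤-Reasoning

  Positive : Carrier → Set ℓ
  Positive x = ¬ (x ≤ 0#)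

  positive⇒nonNeg : ∀ {x} → Positive x → 0# ≤ x
  positive⇒nonNeg = ≰⇒≥

  1≤⇒positive : ∀ {x} → 1# ≤ x → Positive x
  1≤⇒positive 1≤x x≤0 = 1≰0 (≤-trans 1≤x x≤0)

  1≤⇒nonNeg : ∀ {x} → 1# ≤ x → 0# ≤ x
  1≤⇒nonNeg = ≤-trans 0≤1

  +-mono-≤ : ∀ {x y u v} → x ≤ y → u ≤ v → x + u ≤ y + v
  +-mono-≤ {y = y} {u} x≤y u≤v = ≤-trans (+-monoʳ-≤ u x≤y) (+-monoˡ-≤ y u≤v)

  +-nonNeg : ∀ {x y} → 0# ≤ x → 0# ≤ y → 0# ≤ x + y
  +-nonNeg 0≤x 0≤y = ≤-respˡ-≈ (+-identityʳ 0#) (+-mono-≤ 0≤x 0≤y)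

  x≤x+y : ∀ {x y} → 0# ≤ y → x ≤ x + y
  x≤x+y {x} 0≤y = ≤-respˡ-≈ (+-identityʳ x) (+-monoˡ-≤ x 0≤y)

  +-cancelˡ-≤ : ∀ {x y} z → z + x ≤ z + y → x ≤ y
  +-cancelˡ-≤ z le = +-cancelʳ-≤ z (≤-respˡ-≈ (+-comm z _) (≤-respʳ-≈ (+-comm z _) le))

  *-mono-≥1 : ∀ {x y} → 1# ≤ x → 1# ≤ y → 1# ≤ x * y
  *-mono-≥1 1≤x 1≤y = ≤-respˡ-≈ (*-identityˡ 1#) (*-mono-≤ 0≤1 (1≤⇒nonNeg 1≤y) 1≤x 1≤y)

  x-y+y≈x : ∀ x y → (x - y) + y ≈ x
  x-y+y≈x x y = trans (+-assoc x (- y) y) (trans (+-congˡ (-‿inverseˡ y)) (+-identityʳ x))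

  ≰⇒positive-difference : ∀ {x y} → ¬ (x ≤ y) → Positive (x - y)
  ≰⇒positive-difference {x} {y} x≰y x-y≤0 =
    x≰y (≤-respˡ-≈ (x-y+y≈x x y) (≤-respʳ-≈ (+-identityˡ y) (+-monoʳ-≤ y x-y≤0)))

  x*x⁻¹≈1 : ∀ {x} → Positive x → x * x ⁻¹ ≈ 1#
  x*x⁻¹≈1 x>0 = ⁻¹-inverseʳ (≰0⇒≉0 x>0)

  x⁻¹*x≈1 : ∀ {x} → Positive x → x ⁻¹ * x ≈ 1#
  x⁻¹*x≈1 x>0 = trans (*-comm _ _) (x*x⁻¹≈1 x>0)

  ⁻¹-positive : ∀ {x} → Positive x → Positive (x ⁻¹)
  ⁻¹-positive {x} x>0 x⁻¹≤0 = 1≰0 (begin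
    1#        ≈⟨ x*x⁻¹≈1 x>0 ⟨
    x * x ⁻¹  ≤⟨ *-monoˡ-≤ (≰⇒≥ x>0) x⁻¹≤0 ⟩
    x * 0#    ≈⟨ zeroʳ x ⟩
    0#        ∎)

  [x*y⁻¹]*y≈x : ∀ {y} x → Positive y → (x * y ⁻¹) * y ≈ x
  [x*y⁻¹]*y≈x {y} x y>0 = trans (*-assoc x (y ⁻¹) y) (trans (*-congˡ (x⁻¹*x≈1 y>0)) (*-identityʳ x))

  1^n≈1 : ∀ n → 1# ^ n ≈ 1#
  1^n≈1 zero    = refl
  1^n≈1 (suc n) = trans (*-identityˡ _) (1^n≈1 n)

  fromℕ-+ : ∀ m n → fromℕ (m ℕ.+ n) ≈ fromℕ m + fromℕ n
  fromℕ-+ = ×-homo-+ 1#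

  fromℕ-* : ∀ m n → fromℕ (m ℕ.* n) ≈ fromℕ m * fromℕ n
  fromℕ-* = ×1-homo-*

  fromℕ-mono-≤ : ∀ {m n} → m ℕ.≤ n → fromℕ m ≤ fromℕ n
  fromℕ-mono-≤ {n = n} z≤n = 0≤fromℕ n
  fromℕ-mono-≤ (s≤s m≤n) = +-monoˡ-≤ 1# (fromℕ-mono-≤ m≤n)

  archimedean-* : ∀ {δ} → Positive δ → ∀ D → ∃[ N ] D ≤ fromℕ N * δ
  archimedean-* {δ} δ>0 D with archimedean (D * δ ⁻¹)
  ... | N , le = N , ≤-respˡ-≈ ([x*y⁻¹]*y≈x D δ>0) (*-monoʳ-≤ (≰⇒≥ δ>0) le)

  fromℕ-suc-positive : ∀ n → Positive (fromℕ (suc n))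
  fromℕ-suc-positive n = 1≤⇒positive (x≤x+y (0≤fromℕ n))

  -- If δ = x - y > 0, some n has D ≤ n δ, while the hypothesis at that n gives (n + 1) δ ≤ D.
  squeeze : ∀ {x y} D → (∀ n → x ≤ y + D * fromℕ (suc n) ⁻¹) → x ≤ y
  squeeze {x} {y} D near with x ≤? y
  ... | yes x≤y = x≤y
  ... | no  x≰y with archimedean-* (≰⇒positive-difference x≰y) D
  ...   | n , D≤nδ = ⊥-elim (1≰0 (+-cancelʳ-≤ (fromℕ n) (≤-respʳ-≈ (sym (+-identityˡ _)) 1+n≤n)))
    where
    δ = x - y
    N = fromℕ (suc n)
    δ≤ : δ ≤ D * N ⁻¹
    δ≤ = +-cancelʳ-≤ y (≤-respˡ-≈ (sym (x-y+y≈x x y)) (≤-respʳ-≈ (+-comm y _) (near n)))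
    1+n≤n : N ≤ fromℕ n
    1+n≤n = *-cancelʳ-≤ (≰⇒positive-difference x≰y) (begin
      N * δ             ≈⟨ *-comm N δ ⟩
      δ * N             ≤⟨ *-monoʳ-≤ (0≤fromℕ (suc n)) δ≤ ⟩
      (D * N ⁻¹) * N    ≈⟨ [x*y⁻¹]*y≈x D (fromℕ-suc-positive n) ⟩
      D                 ≤⟨ D≤nδ ⟩
      fromℕ n * δ       ∎)

  -- Bernoulli's inequality for F = E + δ, cleared of denominators.
  bernoulli : ∀ {E δ} → 0# ≤ E → 0# ≤ δ → ∀ n →
              E ^ n * (E + fromℕ n * δ) ≤ (E + δ) ^ n * E
  bernoulli {E} {δ} 0≤E 0≤δ zero = *-monoˡ-≤ 0≤1 (≤-reflexive (trans (+-congˡ (zeroˡ δ)) (+-identityʳ E)))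
  bernoulli {E} {δ} 0≤E 0≤δ (suc n) = begin
    (E * E ^ n) * (E + (1# + N) * δ)
      ≈⟨ *-congˡ (+-congˡ (trans (distribʳ δ 1# N) (+-congʳ (*-identityˡ δ)))) ⟩
    (E * E ^ n) * (E + (δ + N * δ))
      ≤⟨ x≤x+y (*-nonNeg (^-nonNeg n 0≤E) (*-nonNeg (*-nonNeg (0≤fromℕ n) 0≤δ) 0≤δ)) ⟩
    (E * E ^ n) * (E + (δ + N * δ)) + E ^ n * (N * δ * δ)
      ≈⟨ solve 4 (λ e x n d → (e :* x) :* (e :+ (d :+ n :* d)) :+ x :* (n :* d :* d)
           := (e :+ d) :* (x :* (e :+ n :* d))) refl E (E ^ n) N δ ⟩
    (E + δ) * (E ^ n * (E + N * δ))
      ≤⟨ *-monoˡ-≤ (+-nonNeg 0≤E 0≤δ) (bernoulli 0≤E 0≤δ n) ⟩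
    (E + δ) * ((E + δ) ^ n * E)
      ≈⟨ *-assoc _ _ _ ⟨
    (E + δ) ^ suc n * E ∎
    where N = fromℕ n

  -- If δ = F - E > 0, Bernoulli gives Fⁿ / Eⁿ ≥ 1 + n δ / E, which outgrows x. This discards a
  -- constant factor from a comparison of powers.
  growth : ∀ {x E F} → Positive E → (∀ n → F ^ n ≤ x * E ^ n) → F ≤ E
  growth {x} {E} {F} E>0 bound with F ≤? E
  ... | yes F≤E = F≤E
  ... | no  F≰E with archimedean-* (≰⇒positive-difference F≰E) (x * E)
  ...   | n , xE≤nδ = ⊥-elim (E>0 (+-cancelʳ-≤ (fromℕ n * δ) (begin
    E + fromℕ n * δ   ≤⟨ *-cancelʳ-≤ (^-pos n E>0) step ⟩
    x * E             ≤⟨ xE≤nδ ⟩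
    fromℕ n * δ       ≈⟨ +-identityˡ _ ⟨
    0# + fromℕ n * δ  ∎)))
    where
    δ = F - E
    step : (E + fromℕ n * δ) * E ^ n ≤ (x * E) * E ^ n
    step = begin
      (E + fromℕ n * δ) * E ^ n  ≈⟨ *-comm _ _ ⟩
      E ^ n * (E + fromℕ n * δ)  ≤⟨ bernoulli (≰⇒≥ E>0) (≰⇒≥ (≰⇒positive-difference F≰E)) n ⟩
      (E + δ) ^ n * E            ≈⟨ *-congʳ (^-congˡ n (trans (+-comm E δ) (x-y+y≈x F E))) ⟩
      F ^ n * E                  ≤⟨ *-monoʳ-≤ (≰⇒≥ E>0) (bound n) ⟩
      (x * E ^ n) * E            ≈⟨ solve 3 (λ x e f → (x :* f) :* e := (x :* e) :* f) refl x E (E ^ n) ⟩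
      (x * E) * E ^ n            ∎

  -- Induction using ε² ≤ ε, which yields `K` = 2ⁿ - 1; what matters is that it does not depend on
  -- ε.
  [1+ε]^n≤1+Kε : ∀ n → ∃[ K ] 0# ≤ K × (∀ {ε} → 0# ≤ ε → ε ≤ 1# → (1# + ε) ^ n ≤ 1# + K * ε)
  [1+ε]^n≤1+Kε zero = 0# , ≤-refl , λ {ε} _ _ →
    ≤-reflexive (sym (trans (+-congˡ (zeroˡ ε)) (+-identityʳ 1#)))
  [1+ε]^n≤1+Kε (suc n) with [1+ε]^n≤1+Kε n
  ... | K , 0≤K , bound = 1# + (K + K) , +-nonNeg 0≤1 (+-nonNeg 0≤K 0≤K) , λ {ε} 0≤ε ε≤1 → begin
    (1# + ε) * (1# + ε) ^ n
      ≤⟨ *-monoˡ-≤ (+-nonNeg 0≤1 0≤ε) (bound 0≤ε ε≤1) ⟩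
    (1# + ε) * (1# + K * ε)
      ≈⟨ trans (distribʳ _ 1# ε) (+-cong (*-identityˡ _) (trans (distribˡ ε 1# (K * ε)) (+-congʳ (*-identityʳ ε)))) ⟩
    (1# + K * ε) + (ε + ε * (K * ε))
      ≤⟨ +-monoˡ-≤ _ (+-monoˡ-≤ ε (*-monoʳ-≤ (*-nonNeg 0≤K 0≤ε) ε≤1)) ⟩
    (1# + K * ε) + (ε + 1# * (K * ε))
      ≈⟨ +-congˡ (+-congʳ (*-identityˡ ε)) ⟨
    (1# + K * ε) + (1# * ε + 1# * (K * ε))
      ≈⟨ +-congˡ (+-congˡ (*-identityˡ _)) ⟩
    (1# + K * ε) + (1# * ε + K * ε)
      ≈⟨ solve 3 (λ o k e → (o :+ k :* e) :+ (o :* e :+ k :* e) := o :+ (o :+ (k :+ k)) :* e) refl 1# K ε ⟩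
    1# + (1# + (K + K)) * ε ∎

  -- The root s is the supremum of the y ≥ 0 with y^(n+1) ≤ c. For ε = 1 / (m + 1), s (1 + ε) is too
  -- large for that set and s / (1 + ε) lies below one of its members, so s^(n+1) and c agree up to
  -- a factor 1 + K ε either way; `squeeze` removes ε.
  root : ∀ n {c} → 1# ≤ c → ∃[ r ] 0# ≤ r × r ^ suc n ≈ c
  root n {c} 1≤c = s , 0≤s , antisym (squeeze (c * K) above) (squeeze (s ^ suc n * K) below)
    where
    P : Carrier → Set ℓ
    P y = 0# ≤ y × y ^ suc n ≤ c
    c≤c^ : c ≤ c ^ suc n
    c≤c^ = ≤-respˡ-≈ (*-identityʳ c) (*-monoˡ-≤ (1≤⇒nonNeg 1≤c) (1≤^ n 1≤c))
    1^≤c : 1# ^ suc n ≤ c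
    1^≤c = ≤-respˡ-≈ (sym (1^n≈1 (suc n))) 1≤c
    sup = complete P (1# , 0≤1 , 1^≤c)
      (c , λ (0≤y , y^≤c) → ^-cancelˡ-≤ n 0≤y (1≤⇒nonNeg 1≤c) (≤-trans y^≤c c≤c^))
    s = proj₁ sup
    1≤s : 1# ≤ s
    1≤s = proj₁ (proj₂ sup) (0≤1 , 1^≤c)
    0≤s : 0# ≤ s
    0≤s = 1≤⇒nonNeg 1≤s
    K = proj₁ ([1+ε]^n≤1+Kε (suc n))
    module _ (m : ℕ) where
      N = fromℕ (suc m)
      N>0 = fromℕ-suc-positive m
      ε = N ⁻¹
      ε>0 = ⁻¹-positive N>0
      ε≤1 : ε ≤ 1#
      ε≤1 = begin
        ε       ≈⟨ *-identityˡ ε ⟨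
        1# * ε  ≤⟨ *-monoʳ-≤ (≰⇒≥ ε>0) (x≤x+y (0≤fromℕ m)) ⟩
        N * ε   ≈⟨ x*x⁻¹≈1 N>0 ⟩
        1#      ∎
      0≤1+ε : 0# ≤ 1# + ε
      0≤1+ε = +-nonNeg 0≤1 (≰⇒≥ ε>0)
      1+ε>0 : Positive (1# + ε)
      1+ε>0 = 1≤⇒positive (x≤x+y (≰⇒≥ ε>0))
      dilate : ∀ {y z} → 0# ≤ y → y ^ suc n ≤ z → (y * (1# + ε)) ^ suc n ≤ z + (z * K) * ε
      dilate {y} {z} 0≤y y^≤z = begin
        (y * (1# + ε)) ^ suc n         ≈⟨ ^-distrib-* y (1# + ε) (suc n) ⟩
        y ^ suc n * (1# + ε) ^ suc n   ≤⟨ *-mono-≤ (^-nonNeg (suc n) 0≤y) 0≤1+Kε y^≤z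
                                           (proj₂ (proj₂ ([1+ε]^n≤1+Kε (suc n))) (≰⇒≥ ε>0) ε≤1) ⟩
        z * (1# + K * ε)               ≈⟨ trans (distribˡ z 1# (K * ε)) (+-cong (*-identityʳ z) (sym (*-assoc z K ε))) ⟩
        z + (z * K) * ε                ∎
        where
        0≤1+Kε = +-nonNeg 0≤1 (*-nonNeg (proj₁ (proj₂ ([1+ε]^n≤1+Kε (suc n)))) (≰⇒≥ ε>0))
      below : c ≤ s ^ suc n + (s ^ suc n * K) * ε
      below with c ≤? (s * (1# + ε)) ^ suc n
      ... | yes le = ≤-trans le (dilate 0≤s ≤-refl)
      ... | no  ≰  = ⊥-elim (*-pos (1≤⇒positive 1≤s) ε>0 (+-cancelˡ-≤ s (begin
        s + s * ε       ≈⟨ +-congʳ (*-identityʳ s) ⟨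
        s * 1# + s * ε  ≈⟨ distribˡ s 1# ε ⟨
        s * (1# + ε)    ≤⟨ proj₁ (proj₂ sup) (*-nonNeg 0≤s 0≤1+ε , ≰⇒≥ ≰) ⟩
        s               ≈⟨ +-identityʳ s ⟨
        s + 0#          ∎)))
      t = s * (1# + ε) ⁻¹
      t<s : t < s
      t<s = ≰⇒> λ s≤t → *-pos (1≤⇒positive 1≤s) ε>0 (+-cancelˡ-≤ s (begin
        s + s * ε       ≈⟨ +-congʳ (*-identityʳ s) ⟨
        s * 1# + s * ε  ≈⟨ distribˡ s 1# ε ⟨
        s * (1# + ε)    ≤⟨ *-monoʳ-≤ 0≤1+ε s≤t ⟩
        t * (1# + ε)    ≈⟨ [x*y⁻¹]*y≈x s 1+ε>0 ⟩
        s               ≈⟨ +-identityʳ s ⟨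
        s + 0#          ∎))
      above : s ^ suc n ≤ c + (c * K) * ε
      above with proj₂ (proj₂ sup) t<s
      ... | y , (0≤y , y^≤c) , t<y = ≤-trans
        (^-monoˡ-≤ (suc n) 0≤s (≤-respˡ-≈ ([x*y⁻¹]*y≈x s 1+ε>0) (*-monoʳ-≤ 0≤1+ε (proj₁ t<y))))
        (dilate 0≤y y^≤c)

-- Real powers and their laws.

module RealPowers {ℓ : Level} (ℝ : CompleteOrderedField ℓ) where
  open RealLinearAlgebra ℝ
  open OrderedFieldProperties ℝ
  open OrderedFieldLemmas ℝ
  open ≤-Reasoning

  -- For x ≥ 1 and a ≥ 0 these two conditions say that F = x^a, in terms of the
  -- rational exponents i / n on either side of a.
  record IsPower (x a F : Carrier) : Set ℓ where
    field
      low  : ∀ n i → fromℕ i ≤ fromℕ n * a → x ^ i ≤ F ^ n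
      high : ∀ n i → fromℕ n * a ≤ fromℕ i → F ^ n ≤ x ^ i

  open IsPower

  floor : ∀ {r} → 0# ≤ r → ∃[ i ] fromℕ i ≤ r × r ≤ fromℕ (suc i)
  floor {r} 0≤r = search (proj₁ (archimedean r)) (proj₂ (archimedean r))
    where
    search : ∀ N → r ≤ fromℕ N → ∃[ i ] fromℕ i ≤ r × r ≤ fromℕ (suc i)
    search zero    r≤0 = 0 , 0≤r , ≤-trans r≤0 (0≤fromℕ 1)
    search (suc N) r≤N+1 with r ≤? fromℕ N
    ... | yes r≤N = search N r≤N
    ... | no  r≰N = N , ≰⇒≥ r≰N , r≤N+1

  -- For positive n and n′ this is (i′ - j′) / n′ ≤ a ≤ i / n, cleared of denominators and with j′
  -- moved across, so that the comparison descends to ℕ.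
  common-denominator : ∀ n n′ i i′ j′ {a} → fromℕ n * a ≤ fromℕ i →
                       fromℕ i′ ≤ fromℕ n′ * a + fromℕ j′ →
                       i′ ℕ.* n ℕ.≤ n′ ℕ.* i ℕ.+ j′ ℕ.* n
  common-denominator n n′ i i′ j′ {a} na≤i i′≤ = fromℕ-cancel-≤ _ _ (begin
    fromℕ (i′ ℕ.* n)                             ≈⟨ fromℕ-* i′ n ⟩
    fromℕ i′ * fromℕ n                           ≤⟨ *-monoʳ-≤ (0≤fromℕ n) i′≤ ⟩
    (fromℕ n′ * a + fromℕ j′) * fromℕ n
      ≈⟨ solve 4 (λ m a j n → (m :* a :+ j) :* n := m :* (n :* a) :+ j :* n) refl (fromℕ n′) a (fromℕ j′) (fromℕ n) ⟩
    fromℕ n′ * (fromℕ n * a) + fromℕ j′ * fromℕ n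
      ≤⟨ +-monoʳ-≤ _ (*-monoˡ-≤ (0≤fromℕ n′) na≤i) ⟩
    fromℕ n′ * fromℕ i + fromℕ j′ * fromℕ n      ≈⟨ +-cong (fromℕ-* n′ i) (fromℕ-* j′ n) ⟨
    fromℕ (n′ ℕ.* i) + fromℕ (j′ ℕ.* n)          ≈⟨ fromℕ-+ (n′ ℕ.* i) (j′ ℕ.* n) ⟨
    fromℕ (n′ ℕ.* i ℕ.+ j′ ℕ.* n)                ∎)

  -- This is y ≤ x^((i′-j′)/n′) ≤ x^(i/n) = r, raised to the power n′ n so that only natural
  -- exponents occur; the roots are cancelled where it is applied.
  rational-power-≤ : ∀ n n′ i i′ j′ {x a y r} → 1# ≤ x → 0# ≤ y → r ^ n ≈ x ^ i →
                     fromℕ n * a ≤ fromℕ i → fromℕ i′ ≤ fromℕ n′ * a + fromℕ j′ →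
                     y ^ n′ * x ^ j′ ≤ x ^ i′ → (y ^ n′) ^ n ≤ (r ^ n′) ^ n
  rational-power-≤ n n′ i i′ j′ {x} {a} {y} {r} 1≤x 0≤y r^n≈x^i na≤i i′≤ y≤ =
    *-cancelʳ-≤ (^-pos (j′ ℕ.* n) (1≤⇒positive 1≤x)) (begin
      (y ^ n′) ^ n * x ^ (j′ ℕ.* n)       ≈⟨ *-congˡ (^-assocʳ x j′ n) ⟨
      (y ^ n′) ^ n * (x ^ j′) ^ n         ≈⟨ ^-distrib-* _ _ n ⟨
      (y ^ n′ * x ^ j′) ^ n               ≤⟨ ^-monoˡ-≤ n (*-nonNeg (^-nonNeg n′ 0≤y) (^-nonNeg j′ (1≤⇒nonNeg 1≤x))) y≤ ⟩
      (x ^ i′) ^ n                        ≈⟨ ^-assocʳ x i′ n ⟩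
      x ^ (i′ ℕ.* n)                      ≤⟨ ^-monoʳ-≤ 1≤x (common-denominator n n′ i i′ j′ na≤i i′≤) ⟩
      x ^ (n′ ℕ.* i ℕ.+ j′ ℕ.* n)         ≈⟨ ^-homo-* x (n′ ℕ.* i) (j′ ℕ.* n) ⟩
      x ^ (n′ ℕ.* i) * x ^ (j′ ℕ.* n)     ≈⟨ *-congʳ x^≈ ⟩
      (r ^ n′) ^ n * x ^ (j′ ℕ.* n)       ∎)
    where
    x^≈ : x ^ (n′ ℕ.* i) ≈ (r ^ n′) ^ n
    x^≈ = begin-equality
      x ^ (n′ ℕ.* i)  ≈⟨ ^-congʳ x (ℕ.*-comm n′ i) ⟩
      x ^ (i ℕ.* n′)  ≈⟨ ^-assocʳ x i n′ ⟨
      (x ^ i) ^ n′    ≈⟨ ^-congˡ n′ r^n≈x^i ⟨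
      (r ^ n) ^ n′    ≈⟨ ^-assocʳ r n n′ ⟩
      r ^ (n ℕ.* n′)  ≈⟨ ^-congʳ r (ℕ.*-comm n n′) ⟩
      r ^ (n′ ℕ.* n)  ≈⟨ ^-assocʳ r n′ n ⟨
      (r ^ n′) ^ n    ∎

  power≥1-isSupremum : ∀ {x a} (1≤x : 1# ≤ x) → IsSupremum (BelowPower x a) (power≥1 x a 1≤x)
  -- The call repeats the one in the definition of `power≥1`, so its second component speaks of that
  -- very value.
  power≥1-isSupremum {x} {a} 1≤x = proj₂ (complete (BelowPower x a) (belowPower-inhabited a 1≤x)
    (let N , a≤N = archimedean a in _ , belowPower-bound N 1≤x a≤N))

  -- The n-th root of x^i settles both bounds: it belongs to the set if i / n ≤ a, and it bounds the
  -- set from above if a ≤ i / n.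
  power≥1-isPower : ∀ {x a} (1≤x : 1# ≤ x) → 0# ≤ a → IsPower x a (power≥1 x a 1≤x)
  power≥1-isPower {x} {a} 1≤x 0≤a = isPower (power≥1-isSupremum 1≤x)
    where
    isPower : ∀ {E} → IsSupremum (BelowPower x a) E → IsPower x a E
    isPower {E} (upper , approx) = record { low = low′ ; high = high′ }
      where
      low′ : ∀ n i → fromℕ i ≤ fromℕ n * a → x ^ i ≤ E ^ n
      low′ zero    i i≤0 with fromℕ-cancel-≤ i 0 (≤-respʳ-≈ (zeroˡ a) i≤0)
      ... | z≤n = ≤-refl
      low′ (suc n) i i≤na = let r , 0≤r , r^≈ = root n (1≤^ i 1≤x) in ≤-respˡ-≈ r^≈ (^-monoˡ-≤ (suc n) 0≤r (upper
        (0≤r , n , i , 0 , ≤-respʳ-≈ (sym (+-identityʳ _)) i≤na , ≤-reflexive (trans (*-identityʳ _) r^≈))))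

      1≤E : 1# ≤ E
      1≤E = upper (0≤1 , 0 , 0 , 0 ,
        ≤-respʳ-≈ (sym (+-identityʳ _)) (*-nonNeg (0≤fromℕ 1) 0≤a) ,
        ≤-reflexive (trans (*-identityʳ _) (*-identityʳ _)))

      high′ : ∀ n i → fromℕ n * a ≤ fromℕ i → E ^ n ≤ x ^ i
      high′ zero    i _ = 1≤^ i 1≤x
      high′ (suc n) i na≤i = let r , 0≤r , r^≈ = root n (1≤^ i 1≤x) in
        ≤-respʳ-≈ r^≈ (^-monoˡ-≤ (suc n) (≤-trans 0≤1 1≤E) (E≤r 0≤r r^≈))
        where
        below : ∀ {r y} → 0# ≤ r → r ^ suc n ≈ x ^ i → BelowPower x a y → y ≤ r
        below 0≤r r^≈ (0≤y , n′ , i′ , j′ , i′≤ , y≤) =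
          ^-cancelˡ-≤ n′ 0≤y 0≤r (^-cancelˡ-≤ n (^-nonNeg (suc n′) 0≤y) (^-nonNeg (suc n′) 0≤r)
          (rational-power-≤ (suc n) (suc n′) i i′ j′ 1≤x 0≤y r^≈ na≤i i′≤ y≤))
        E≤r : ∀ {r} → 0# ≤ r → r ^ suc n ≈ x ^ i → E ≤ r
        E≤r {r} 0≤r r^≈ with E ≤? r
        ... | yes le = le
        ... | no  ≰  with approx (≰⇒> ≰)
        ...   | y , y∈P , r<y = ⊥-elim (<⇒≱ r<y (below 0≤r r^≈ y∈P))

  isPower-1≤ : ∀ {x a F} → 0# ≤ a → IsPower x a F → 1# ≤ F
  isPower-1≤ {a = a} 0≤a F = ≤-respʳ-≈ (*-identityʳ _) (low F 1 0 (*-nonNeg (0≤fromℕ 1) 0≤a))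

  -- Rounding n a to a natural number costs a single factor y, whatever n is, and `growth` absorbs
  -- it.
  isPower-mono : ∀ {x y a F G} → 0# ≤ a → 1# ≤ x → x ≤ y → IsPower x a F → IsPower y a G → F ≤ G
  isPower-mono {x} {y} {a} {F} {G} 0≤a 1≤x x≤y x^a y^a = growth {x = y} (1≤⇒positive (isPower-1≤ 0≤a y^a)) bound
    where
    bound : ∀ n → F ^ n ≤ y * G ^ n
    bound n with floor (*-nonNeg (0≤fromℕ n) 0≤a)
    ... | i , i≤na , na≤1+i = begin
      F ^ n      ≤⟨ high x^a n (suc i) na≤1+i ⟩
      x ^ suc i  ≤⟨ ^-monoˡ-≤ (suc i) (1≤⇒nonNeg 1≤x) x≤y ⟩
      y * y ^ i  ≤⟨ *-monoˡ-≤ (1≤⇒nonNeg (≤-trans 1≤x x≤y)) (low y^a n i i≤na) ⟩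
      y * G ^ n  ∎

  isPower-* : ∀ {x y a F G} → 1# ≤ x → 1# ≤ y → 0# ≤ a →
              IsPower x a F → IsPower y a G → IsPower (x * y) a (F * G)
  isPower-* {x} {y} {a} {F} {G} 1≤x 1≤y 0≤a x^a y^a = record
    { low  = λ n i le → ≤-respˡ-≈ (sym (^-distrib-* x y i)) (≤-respʳ-≈ (sym (^-distrib-* F G n))
        (*-mono-≤ (^-nonNeg i (1≤⇒nonNeg 1≤x)) (^-nonNeg n (1≤⇒nonNeg (isPower-1≤ 0≤a y^a)))
                  (low x^a n i le) (low y^a n i le)))
    ; high = λ n i le → ≤-respˡ-≈ (sym (^-distrib-* F G n)) (≤-respʳ-≈ (sym (^-distrib-* x y i))
        (*-mono-≤ (^-nonNeg n (1≤⇒nonNeg (isPower-1≤ 0≤a x^a))) (^-nonNeg i (1≤⇒nonNeg 1≤y))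
                  (high x^a n i le) (high y^a n i le)))
    }

  -- As i ≤ n b becomes i a ≤ n, the two bounds trade places and numerators trade places with
  -- denominators.
  isPower-inverse : ∀ {x a b F} → 0# ≤ a → 0# ≤ b → a * b ≈ 1# → IsPower x a F → IsPower F b x
  isPower-inverse {x} {a} {b} {F} 0≤a 0≤b ab≈1 x^a = record
    { low  = λ n i i≤nb → high x^a i n
        (≤-respʳ-≈ (n*b*a≈n (fromℕ n)) (*-monoʳ-≤ 0≤a i≤nb))
    ; high = λ n i nb≤i → low x^a i n
        (≤-respˡ-≈ (n*b*a≈n (fromℕ n)) (*-monoʳ-≤ 0≤a nb≤i))
    }
    where
    n*b*a≈n : ∀ n → (n * b) * a ≈ n
    n*b*a≈n n = trans (*-assoc n b a) (trans (*-congˡ (trans (*-comm b a) ab≈1)) (*-identityʳ n))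

  0≤2 : 0# ≤ 2#
  0≤2 = +-nonNeg 0≤1 0≤1

  isPower-2 : ∀ {x} → 1# ≤ x → IsPower x 2# (x * x)
  isPower-2 {x} 1≤x = record
    { low  = λ n i le → ≤-respʳ-≈ (sym (square n))
        (^-monoʳ-≤ 1≤x (fromℕ-cancel-≤ i (n ℕ.+ n) (≤-respʳ-≈ (double n) le)))
    ; high = λ n i le → ≤-respˡ-≈ (sym (square n))
        (^-monoʳ-≤ 1≤x (fromℕ-cancel-≤ (n ℕ.+ n) i (≤-respˡ-≈ (double n) le)))
    }
    where
    square : ∀ n → (x * x) ^ n ≈ x ^ (n ℕ.+ n)
    square n = trans (^-distrib-* x x n) (sym (^-homo-* x n n))
    double : ∀ n → fromℕ n * 2# ≈ fromℕ (n ℕ.+ n)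
    double n = trans (distribˡ _ 1# 1#) (trans (+-cong (*-identityʳ _) (*-identityʳ _)) (sym (fromℕ-+ n n)))

  -- y = x^a for x ≥ 0: below 1 the base is written as a quotient u / v of
  -- reals u, v ≥ 1, which makes every case x ≷ 1 uniform.
  data Power (x a y : Carrier) : Set ℓ where
    vanishing : x ≈ 0# → y ≈ 0# → Power x a y
    quotient  : ∀ {u v F G} → 1# ≤ u → 1# ≤ v → x * v ≈ u →
                IsPower u a F → IsPower v a G → y * G ≈ F → Power x a y

  isPower-1 : ∀ {a} → 0# ≤ a → IsPower 1# a 1#
  isPower-1 0≤a = record
    { low  = λ n i _ → ≤-reflexive (trans (1^n≈1 i) (sym (1^n≈1 n)))
    ; high = λ n i _ → ≤-reflexive (trans (1^n≈1 n) (sym (1^n≈1 i)))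
    }

  ^ʳ-power : ∀ {x a} → 0# ≤ x → 0# ≤ a → Power x a (x ^ʳ a)
  ^ʳ-power {x} {a} 0≤x 0≤a with 1# ≤? x
  ... | yes 1≤x = quotient 1≤x ≤-refl (*-identityʳ x) (power≥1-isPower 1≤x 0≤a) (isPower-1 0≤a) (*-identityʳ _)
  ... | no  1≰x with x ≤? 0#
  ...   | yes x≤0 = vanishing (antisym x≤0 0≤x) refl
  ...   | no  x≰0 = quotient ≤-refl (1≤x⁻¹ x≰0 1≰x) (x*x⁻¹≈1 x≰0) (isPower-1 0≤a) isP
                      (x⁻¹*x≈1 (1≤⇒positive (isPower-1≤ 0≤a isP)))
    where isP = power≥1-isPower (1≤x⁻¹ x≰0 1≰x) 0≤a

  positive-quotient : ∀ {x v u} → 1# ≤ v → 1# ≤ u → x * v ≈ u → Positive x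
  positive-quotient {v = v} 1≤v 1≤u eq x≤0 = 1≤⇒positive 1≤u
    (≤-respˡ-≈ eq (≤-respʳ-≈ (zeroˡ v) (*-monoʳ-≤ (1≤⇒nonNeg 1≤v) x≤0)))

  power-nonNeg : ∀ {x a y} → 0# ≤ a → Power x a y → 0# ≤ y
  power-nonNeg 0≤a (vanishing _ y≈0) = ≤-reflexive (sym y≈0)
  power-nonNeg 0≤a (quotient _ _ _ F G eq) = ≰⇒≥ (positive-quotient (isPower-1≤ 0≤a G) (isPower-1≤ 0≤a F) eq)

  -- For two quotients, x ≤ x′ reads u v′ ≤ u′ v. Both products are at least 1, so `isPower-mono`
  -- applies to them.
  power-mono : ∀ {x x′ a y y′} → 0# ≤ a → x ≤ x′ → Power x a y → Power x′ a y′ → y ≤ y′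
  power-mono 0≤a x≤x′ (vanishing _ y≈0) p′ = ≤-respˡ-≈ (sym y≈0) (power-nonNeg 0≤a p′)
  power-mono 0≤a x≤x′ (quotient 1≤u 1≤v xv≈u _ _ _) (vanishing x′≈0 _) =
    ⊥-elim (positive-quotient 1≤v 1≤u xv≈u (≤-respʳ-≈ x′≈0 x≤x′))
  power-mono {x} {x′} {a} {y} {y′} 0≤a x≤x′
    (quotient {u} {v} {F} {G} 1≤u 1≤v xv≈u u^a v^a yG≈F)
    (quotient {u′} {v′} {F′} {G′} 1≤u′ 1≤v′ x′v′≈u′ u′^a v′^a y′G′≈F′) =
    *-cancelʳ-≤ (*-pos (1≤⇒positive (isPower-1≤ 0≤a v^a)) (1≤⇒positive (isPower-1≤ 0≤a v′^a))) (begin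
      y * (G * G′)   ≈⟨ *-assoc y G G′ ⟨
      (y * G) * G′   ≈⟨ *-congʳ yG≈F ⟩
      F * G′         ≤⟨ isPower-mono 0≤a (*-mono-≥1 1≤u 1≤v′) uv′≤u′v
                          (isPower-* 1≤u 1≤v′ 0≤a u^a v′^a) (isPower-* 1≤u′ 1≤v 0≤a u′^a v^a) ⟩
      F′ * G         ≈⟨ *-congʳ y′G′≈F′ ⟨
      (y′ * G′) * G  ≈⟨ *-assoc y′ G′ G ⟩
      y′ * (G′ * G)  ≈⟨ *-congˡ (*-comm G′ G) ⟩
      y′ * (G * G′)  ∎)
    where
    uv′≤u′v : u * v′ ≤ u′ * v
    uv′≤u′v = begin
      u * v′         ≈⟨ *-congʳ xv≈u ⟨
      (x * v) * v′   ≤⟨ *-monoʳ-≤ (1≤⇒nonNeg 1≤v′) (*-monoʳ-≤ (1≤⇒nonNeg 1≤v) x≤x′) ⟩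
      (x′ * v) * v′  ≈⟨ solve 3 (λ x v w → (x :* v) :* w := (x :* w) :* v) refl x′ v v′ ⟩
      (x′ * v′) * v  ≈⟨ *-congʳ x′v′≈u′ ⟩
      u′ * v         ∎

  power-* : ∀ {x x′ a y y′} → 0# ≤ a → Power x a y → Power x′ a y′ → Power (x * x′) a (y * y′)
  power-* 0≤a (vanishing x≈0 y≈0) _ = vanishing (trans (*-congʳ x≈0) (zeroˡ _)) (trans (*-congʳ y≈0) (zeroˡ _))
  power-* 0≤a (quotient _ _ _ _ _ _) (vanishing x≈0 y≈0) =
    vanishing (trans (*-congˡ x≈0) (zeroʳ _)) (trans (*-congˡ y≈0) (zeroʳ _))
  power-* 0≤a (quotient 1≤u 1≤v xv≈u u^a v^a yG≈F) (quotient 1≤u′ 1≤v′ x′v′≈u′ u′^a v′^a y′G′≈F′) =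
    quotient (*-mono-≥1 1≤u 1≤u′) (*-mono-≥1 1≤v 1≤v′)
      (trans (interchange _ _ _ _) (*-cong xv≈u x′v′≈u′))
      (isPower-* 1≤u 1≤u′ 0≤a u^a u′^a) (isPower-* 1≤v 1≤v′ 0≤a v^a v′^a)
      (trans (interchange _ _ _ _) (*-cong yG≈F y′G′≈F′))
    where
    interchange : ∀ w x y z → (w * x) * (y * z) ≈ (w * y) * (x * z)
    interchange = solve 4 (λ w x y z → (w :* x) :* (y :* z) := (w :* y) :* (x :* z)) refl

  power-inverse : ∀ {x a b y} → 0# ≤ a → 0# ≤ b → a * b ≈ 1# → Power x a y → Power y b x
  power-inverse 0≤a 0≤b ab≈1 (vanishing x≈0 y≈0) = vanishing y≈0 x≈0
  power-inverse 0≤a 0≤b ab≈1 (quotient 1≤u 1≤v xv≈u u^a v^a yG≈F) =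
    quotient (isPower-1≤ 0≤a u^a) (isPower-1≤ 0≤a v^a) yG≈F
      (isPower-inverse 0≤a 0≤b ab≈1 u^a) (isPower-inverse 0≤a 0≤b ab≈1 v^a) xv≈u

  power-2 : ∀ {x a y} → Power x a y → Power x 2# (x * x)
  power-2 (vanishing x≈0 _) = vanishing x≈0 (trans (*-congʳ x≈0) (zeroˡ _))
  power-2 (quotient {u} {v} 1≤u 1≤v xv≈u _ _ _) = quotient 1≤u 1≤v xv≈u (isPower-2 1≤u) (isPower-2 1≤v)
    (trans (solve 2 (λ x v → (x :* x) :* (v :* v) := (x :* v) :* (x :* v)) refl _ v) (*-cong xv≈u xv≈u))

  -- The equations for `_^ʳ_` below all come from here: both sides are exhibited as the same power
  -- of the same base.
  power-unique : ∀ {x x′ a y y′} → 0# ≤ a → x ≈ x′ → Power x a y → Power x′ a y′ → y ≈ y′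
  power-unique 0≤a x≈x′ p p′ = antisym (power-mono 0≤a (≤-reflexive x≈x′) p p′)
                                       (power-mono 0≤a (≤-reflexive (sym x≈x′)) p′ p)

  ^ʳ-nonNeg : ∀ {x a} → 0# ≤ x → 0# ≤ a → 0# ≤ x ^ʳ a
  ^ʳ-nonNeg 0≤x 0≤a = power-nonNeg 0≤a (^ʳ-power 0≤x 0≤a)

  ^ʳ-mono-≤ : ∀ {x y a} → 0# ≤ a → 0# ≤ x → x ≤ y → x ^ʳ a ≤ y ^ʳ a
  ^ʳ-mono-≤ 0≤a 0≤x x≤y = power-mono 0≤a x≤y (^ʳ-power 0≤x 0≤a) (^ʳ-power (≤-trans 0≤x x≤y) 0≤a)

  ^ʳ-cong : ∀ {x y a} → 0# ≤ a → 0# ≤ x → x ≈ y → x ^ʳ a ≈ y ^ʳ a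
  ^ʳ-cong 0≤a 0≤x x≈y = power-unique 0≤a x≈y (^ʳ-power 0≤x 0≤a) (^ʳ-power (≤-respʳ-≈ x≈y 0≤x) 0≤a)

  ^ʳ-distrib-* : ∀ {x y a} → 0# ≤ a → 0# ≤ x → 0# ≤ y → (x * y) ^ʳ a ≈ x ^ʳ a * y ^ʳ a
  ^ʳ-distrib-* 0≤a 0≤x 0≤y = power-unique 0≤a refl (^ʳ-power (*-nonNeg 0≤x 0≤y) 0≤a)
    (power-* 0≤a (^ʳ-power 0≤x 0≤a) (^ʳ-power 0≤y 0≤a))

  ^ʳ-inverse : ∀ {x a b} → 0# ≤ a → 0# ≤ b → a * b ≈ 1# → 0# ≤ x → (x ^ʳ a) ^ʳ b ≈ x
  ^ʳ-inverse 0≤a 0≤b ab≈1 0≤x = power-unique 0≤b refl (^ʳ-power (^ʳ-nonNeg 0≤x 0≤a) 0≤b)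
    (power-inverse 0≤a 0≤b ab≈1 (^ʳ-power 0≤x 0≤a))

  x^ʳ2≈x*x : ∀ {x} → 0# ≤ x → x ^ʳ 2# ≈ x * x
  x^ʳ2≈x*x 0≤x = power-unique 0≤2 refl (^ʳ-power 0≤x 0≤2) (power-2 (^ʳ-power 0≤x 0≤2))

  0^ʳ : ∀ {a} → 0# ≤ a → 0# ^ʳ a ≈ 0#
  0^ʳ 0≤a = power-unique 0≤a refl (^ʳ-power ≤-refl 0≤a) (vanishing refl refl)

  1^ʳ : ∀ {a} → 0# ≤ a → 1# ^ʳ a ≈ 1#
  1^ʳ 0≤a = power-unique 0≤a refl (^ʳ-power 0≤1 0≤a)
    (quotient ≤-refl ≤-refl (*-identityʳ 1#) (isPower-1 0≤a) (isPower-1 0≤a) (*-identityʳ 1#))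

-- Finite sums and maxima.

module Sums {ℓ : Level} (ℝ : CompleteOrderedField ℓ) where
  open CompleteOrderedField ℝ hiding (zero)
  open OrderedFieldProperties ℝ
  open OrderedFieldLemmas ℝ
  open Sum semiring public using (sum; sum-cong-≋; ∑-distrib-+; *-distribˡ-sum; ∑-comm; sum-replicate-zero)

  -- Rank-one updates f = h - c g are kept in the additive form f + c g ≈ h, which the semiring
  -- solver can handle, and are summed in that form.
  sum-+-* : ∀ {n c} {f g h : Fin n → Carrier} → (∀ i → f i + c * g i ≈ h i) → sum f + c * sum g ≈ sum h
  sum-+-* {c = c} {f} {g} eq = trans (+-congˡ (*-distribˡ-sum c g))
    (trans (sym (∑-distrib-+ f (λ i → c * g i))) (sum-cong-≋ eq))

  sum-mono-≤ : ∀ {n} {f g : Fin n → Carrier} → (∀ i → f i ≤ g i) → sum f ≤ sum g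
  sum-mono-≤ {zero}  f≤g = ≤-refl
  sum-mono-≤ {suc n} f≤g = +-mono-≤ (f≤g zero) (sum-mono-≤ (λ i → f≤g (suc i)))

  sum-zero : ∀ {n} {f : Fin n → Carrier} → (∀ i → f i ≈ 0#) → sum f ≈ 0#
  sum-zero {n} f≈0 = trans (sum-cong-≋ f≈0) (sum-replicate-zero n)

  sum-nonNeg : ∀ {n} {f : Fin n → Carrier} → (∀ i → 0# ≤ f i) → 0# ≤ sum f
  sum-nonNeg {n} 0≤f = ≤-respˡ-≈ (sum-replicate-zero n) (sum-mono-≤ 0≤f)

  term≤sum : ∀ {n} {f : Fin n → Carrier} → (∀ i → 0# ≤ f i) → ∀ i → f i ≤ sum f
  term≤sum 0≤f zero    = x≤x+y (sum-nonNeg (λ i → 0≤f (suc i)))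
  term≤sum 0≤f (suc i) = ≤-respˡ-≈ (+-identityˡ _) (+-mono-≤ (0≤f zero) (term≤sum (λ i → 0≤f (suc i)) i))

  sum-1 : ∀ {n} {f : Fin n → Carrier} → (∀ i → f i ≈ 1#) → sum f ≈ fromℕ n
  sum-1 {zero}  f≈1 = refl
  sum-1 {suc n} f≈1 = +-cong (f≈1 zero) (sum-1 (λ i → f≈1 (suc i)))

  maximum : ∀ {n} (f : Fin (suc n) → Carrier) → ∃[ i ] (∀ j → f j ≤ f i)
  maximum {zero}  f = zero , λ where zero → ≤-refl
  maximum {suc n} f with maximum (λ i → f (suc i))
  ... | i , max with f zero ≤? f (suc i)
  ...   | yes le = suc i , λ where
    zero    → le
    (suc j) → max j
  ...   | no  ≰  = zero , λ where
    zero    → ≤-refl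
    (suc j) → ≤-trans (max j) (≰⇒≥ ≰)

  -- An optimal tail for each first entry, then the best first entry.
  maximumList : ∀ {n} N (f : List (Fin (suc n)) → Carrier) →
                ∃[ S ] length S ≡ N × (∀ T → length T ≡ N → f T ≤ f S)
  maximumList zero    f = [] , ≡.refl , λ where [] _ → ≤-refl
  maximumList (suc N) f = i ∷ proj₁ (best i) , ≡.cong suc (proj₁ (proj₂ (best i))) , λ where
      (j ∷ T) eq → ≤-trans (proj₂ (proj₂ (best j)) T (ℕ.suc-injective eq)) (proj₂ max j)
    where
    best : ∀ j → ∃[ S ] length S ≡ N × (∀ T → length T ≡ N → f (j ∷ T) ≤ f (j ∷ S))
    best j = maximumList N (λ S → f (j ∷ S))
    max = maximum (λ j → f (j ∷ proj₁ (best j)))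
    i = proj₁ max

-- A form G₀ on I with an orthonormal basis e; adding the vector pt j to the
-- quadratic form replaces the inverse form G by its Sherman–Morrison update.
module Frames {ℓ : Level} (ℝ : CompleteOrderedField ℓ)
  {I : Set ℓ} {J : Set} (pt : J → I) {m : ℕ} (e : Fin m → I)
  (G₀ : I → I → CompleteOrderedField.Carrier ℝ) where
  open CompleteOrderedField ℝ hiding (zero)
  open OrderedFieldProperties ℝ
  open OrderedFieldLemmas ℝ
  open Sums ℝ
  open RingProperties ring using (+-cancelʳ)
  open ≤-Reasoning

  tilt : (I → I → Carrier) → I → I → Carrier
  tilt G x u = G u x * (1# + G x x) ⁻¹

  form : List J → I → I → Carrier
  form []      = G₀
  form (j ∷ S) u v = form S u v - tilt (form S) (pt j) u * form S (pt j) v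

  frame : ∀ (S : List J) → Fin (length S ℕ.+ m) → I
  frame []      = e
  frame (j ∷ S) zero    = pt j
  frame (j ∷ S) (suc r) = frame S r

  -- The determinant of the quadratic form, by the matrix determinant lemma.
  volume : List J → Carrier
  volume []      = 1#
  volume (j ∷ S) = volume S * (1# + form S (pt j) (pt j))

  -- With M = ∑ y yᵀ over the frame and φ a linear functional, this is M⁻¹ M = I evaluated through
  -- φ. It replaces linearity of φ, as `I` carries no vector space structure.
  Reproduced : List J → (I → Carrier) → Set ℓ
  Reproduced S φ = ∀ u → sum (λ r → form S u (frame S r) * φ (frame S r)) ≈ φ u

  -- Reproducing identities, leverages and volumes.

  module Orthonormal
    (G₀-sym : ∀ u v → G₀ u v ≈ G₀ v u)
    (G₀-reproduced : ∀ v → Reproduced [] (λ u → G₀ u v))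
    (G₀-unit : ∀ l → G₀ (e l) (e l) ≈ 1#)
    where

    form-update : ∀ j S u v → form (j ∷ S) u v + tilt (form S) (pt j) u * form S (pt j) v ≈ form S u v
    form-update j S u v = x-y+y≈x _ _

    reproduced-linear : ∀ {S c φ ψ χ} → Reproduced S φ → Reproduced S ψ →
                        (∀ u → χ u + c * ψ u ≈ φ u) → Reproduced S χ
    reproduced-linear {S} {c} {φ} {ψ} {χ} repφ repψ eq u = +-cancelʳ (c * ψ u) _ _ (begin-equality
      sum (λ r → form S u (frame S r) * χ (frame S r)) + c * ψ u
        ≈⟨ +-congˡ (*-congˡ (repψ u)) ⟨
      sum (λ r → form S u (frame S r) * χ (frame S r)) + c * sum (λ r → form S u (frame S r) * ψ (frame S r))
        ≈⟨ sum-+-* (λ r → trans (rearrange _ _ _ _) (*-congˡ (eq (frame S r)))) ⟩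
      sum (λ r → form S u (frame S r) * φ (frame S r))
        ≈⟨ repφ u ⟩
      φ u
        ≈⟨ eq u ⟨
      χ u + c * ψ u ∎)
      where
      rearrange : ∀ g x c y → g * x + c * (g * y) ≈ g * (x + c * y)
      rearrange = solve 4 (λ g x c y → g :* x :+ c :* (g :* y) := g :* (x :+ c :* y)) refl

    module Step (j : J) (S : List J) (0≤g : 0# ≤ form S (pt j) (pt j)) where
      x = pt j
      G = form S
      G′ = form (j ∷ S)
      g = G x x

      1+g>0 : Positive (1# + g)
      1+g>0 = 1≤⇒positive (x≤x+y 0≤g)

      tilt-* : ∀ u → tilt G x u * (1# + g) ≈ G u x
      tilt-* u = [x*y⁻¹]*y≈x (G u x) 1+g>0

      form-new : ∀ u → G′ u x ≈ tilt G x u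
      form-new u = +-cancelʳ (tilt G x u * g) _ _ (begin-equality
        G′ u x + tilt G x u * g       ≈⟨ form-update j S u x ⟩
        G u x                         ≈⟨ tilt-* u ⟨
        tilt G x u * (1# + g)         ≈⟨ distribˡ _ 1# g ⟩
        tilt G x u * 1# + tilt G x u * g  ≈⟨ +-congʳ (*-identityʳ _) ⟩
        tilt G x u + tilt G x u * g   ∎)

      -- The new frame vector contributes t φ(x), and the rank-one correction subtracts exactly t
      -- φ(x) from the old sum.
      reproduced-step : ∀ {φ} → Reproduced S φ → Reproduced (j ∷ S) φ
      reproduced-step {φ} rep u = begin-equality
        G′ u x * φ x + sum (λ r → G′ u (frame S r) * φ (frame S r))
          ≈⟨ +-congʳ (*-congʳ (form-new u)) ⟩
        t * φ x + sum (λ r → G′ u (frame S r) * φ (frame S r))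
          ≈⟨ +-comm _ _ ⟩
        sum (λ r → G′ u (frame S r) * φ (frame S r)) + t * φ x
          ≈⟨ +-congˡ (*-congˡ (rep x)) ⟨
        sum (λ r → G′ u (frame S r) * φ (frame S r)) + t * sum (λ r → G x (frame S r) * φ (frame S r))
          ≈⟨ sum-+-* (λ r → trans (rearrange _ _ _ _) (*-congʳ (form-update j S u (frame S r)))) ⟩
        sum (λ r → G u (frame S r) * φ (frame S r))
          ≈⟨ rep u ⟩
        φ u ∎
        where
        t = tilt G x u
        rearrange : ∀ a p t b → a * p + t * (b * p) ≈ (a + t * b) * p
        rearrange = solve 4 (λ a p t b → a :* p :+ t :* (b :* p) := (a :+ t :* b) :* p) refl

      -- The factor in front of `G u x` is constant in u, as `reproduced-linear` requires.
      column-update : ∀ v u → G′ u v + ((1# + g) ⁻¹ * G x v) * G u x ≈ G u v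
      column-update v u = trans
        (+-congˡ (solve 3 (λ w a b → (w :* a) :* b := (b :* w) :* a) refl _ (G x v) (G u x)))
        (form-update j S u v)

    sym-cons : ∀ j S → (∀ u v → form S u v ≈ form S v u) → ∀ u v → form (j ∷ S) u v ≈ form (j ∷ S) v u
    sym-cons j S G-sym u v = +-cong (G-sym u v) (-‿cong (begin-equality
      (form S u (pt j) * _) * form S (pt j) v  ≈⟨ *-cong (*-congʳ (G-sym u (pt j))) (G-sym (pt j) v) ⟩
      (form S (pt j) u * _) * form S v (pt j)  ≈⟨ solve 3 (λ a w b → (a :* w) :* b := (b :* w) :* a) refl _ _ _ ⟩
      (form S v (pt j) * _) * form S (pt j) u  ∎))

    form-sym : ∀ S u v → form S u v ≈ form S v u
    form-sym []      = G₀-sym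
    form-sym (j ∷ S) = sym-cons j S (form-sym S)

    square-nonNeg : ∀ x → 0# ≤ x * x
    square-nonNeg x with 0# ≤? x
    ... | yes 0≤x = *-nonNeg 0≤x 0≤x
    ... | no  0≰x = ≤-respʳ-≈ (begin-equality
      - x * - x                      ≈⟨ +-identityʳ _ ⟨
      - x * - x + 0#                 ≈⟨ +-congˡ (trans (*-congʳ (-‿inverseˡ x)) (zeroˡ x)) ⟨
      - x * - x + (- x + x) * x      ≈⟨ solve 2 (λ n x → n :* n :+ (n :+ x) :* x := (n :+ x) :* n :+ x :* x) refl (- x) x ⟩
      (- x + x) * - x + x * x        ≈⟨ +-congʳ (trans (*-congʳ (-‿inverseˡ x)) (zeroˡ _)) ⟩
      0# + x * x                     ≈⟨ +-identityˡ _ ⟩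
      x * x                          ∎) (*-nonNeg 0≤-x 0≤-x)
      where
      0≤-x : 0# ≤ - x
      0≤-x = ≤-respʳ-≈ (+-identityˡ _) (x≤y⇒0≤y-x (≰⇒≥ 0≰x))

    norm-form : ∀ S → (∀ v → Reproduced S (λ u → form S u v)) → ∀ u →
                sum (λ r → form S u (frame S r) * form S u (frame S r)) ≈ form S u u
    norm-form S rep u = trans (sum-cong-≋ (λ r → *-congˡ (form-sym S u (frame S r)))) (rep u u)

    parseval⇒nonNeg : ∀ S → (∀ v → Reproduced S (λ u → form S u v)) → ∀ u → 0# ≤ form S u u
    parseval⇒nonNeg S rep u = ≤-respʳ-≈ (norm-form S rep u) (sum-nonNeg (λ r → square-nonNeg (form S u (frame S r))))

    -- Each update divides by 1 + g. Its positivity comes from the identity for the shorter list,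
    -- which makes g a sum of squares.
    parseval : ∀ S v → Reproduced S (λ u → form S u v)
    parseval []      = G₀-reproduced
    parseval (j ∷ S) v = reproduced-step (reproduced-linear {S} (parseval S v) (parseval S x) (column-update v))
      where open Step j S (parseval⇒nonNeg S (parseval S) (pt j))

    form-nonNeg : ∀ S u → 0# ≤ form S u u
    form-nonNeg S = parseval⇒nonNeg S (parseval S)

    reproduced : ∀ {φ} → Reproduced [] φ → ∀ S → Reproduced S φ
    reproduced rep []      = rep
    reproduced rep (j ∷ S) = Step.reproduced-step j S (form-nonNeg S (pt j)) (reproduced rep S)

    -- By the updates, columns of `form T` are linear combinations of columns of `G₀`, and every S
    -- reproduces those. Having two unrelated lists here is what yields independence of the order.
    form-reproduced : ∀ S T v → Reproduced S (λ u → form T u v)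
    form-reproduced S []      v = reproduced (G₀-reproduced v) S
    form-reproduced S (j ∷ T) v = reproduced-linear {S} (form-reproduced S T v) (form-reproduced S T (pt j))
      (Step.column-update j T (form-nonNeg T (pt j)) v)

    -- This is tr (M⁻¹ M) = m. By Parseval the update lowers the old leverages by w g in total,
    -- which is the leverage of the new vector.
    trace : ∀ S → sum (λ r → form S (frame S r) (frame S r)) ≈ fromℕ m
    trace []      = sum-1 G₀-unit
    trace (j ∷ S) = begin-equality
      G′ x x + sum (λ r → G′ (frame S r) (frame S r))
        ≈⟨ +-congʳ (trans (form-new x) (*-comm g _)) ⟩
      w * g + sum (λ r → G′ (frame S r) (frame S r))
        ≈⟨ +-comm _ _ ⟩
      sum (λ r → G′ (frame S r) (frame S r)) + w * g
        ≈⟨ +-congˡ (*-congˡ (parseval S x x)) ⟨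
      sum (λ r → G′ (frame S r) (frame S r)) + w * sum (λ r → G x (frame S r) * G (frame S r) x)
        ≈⟨ sum-+-* (λ r → trans (+-congˡ (sym (*-assoc w _ _))) (column-update (frame S r) (frame S r))) ⟩
      sum (λ r → G (frame S r) (frame S r))
        ≈⟨ trace S ⟩
      fromℕ m ∎
      where
      open Step j S (form-nonNeg S (pt j))
      w = (1# + g) ⁻¹

    sum-frame-↭ : ∀ {S T} (f : I → Carrier) → S ↭ T → sum (λ r → f (frame S r)) ≈ sum (λ r → f (frame T r))
    sum-frame-↭ f ↭.refl        = refl
    sum-frame-↭ f (prep x p)    = +-congˡ (sum-frame-↭ f p)
    sum-frame-↭ f (swap x y p)  = trans (+-congˡ (+-congˡ (sum-frame-↭ f p)))
      (solve 3 (λ a b c → a :+ (b :+ c) := b :+ (a :+ c)) refl _ _ _)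
    sum-frame-↭ f (↭.trans p q) = trans (sum-frame-↭ f p) (sum-frame-↭ f q)

    -- Each form reproduces the columns of the other, so both equal ∑ᵧ G(u,y) H(y,v).
    form-↭ : ∀ {S T} → S ↭ T → ∀ u v → form S u v ≈ form T u v
    form-↭ {S} {T} p u v = begin-equality
      form S u v
        ≈⟨ form-reproduced T S v u ⟨
      sum (λ r → form T u (frame T r) * form S (frame T r) v)
        ≈⟨ sum-frame-↭ (λ y → form T u y * form S y v) p ⟨
      sum (λ r → form T u (frame S r) * form S (frame S r) v)
        ≈⟨ sum-cong-≋ (λ r → trans (*-comm _ _) (*-cong (form-sym S (frame S r) v) (form-sym T u (frame S r)))) ⟩
      sum (λ r → form S v (frame S r) * form T (frame S r) u)
        ≈⟨ form-reproduced S T u v ⟩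
      form T v u
        ≈⟨ form-sym T v u ⟩
      form T u v ∎

    volume-prep : ∀ {S T} j → S ↭ T → volume S ≈ volume T → volume (j ∷ S) ≈ volume (j ∷ T)
    volume-prep j p eq = *-cong eq (+-congˡ (form-↭ p (pt j) (pt j)))

    -- Relative to `volume S`, both sides are the 2 × 2 determinant (1 + a)(1 + b) - cᵢⱼ cⱼᵢ, which
    -- is symmetric in i and j.
    volume-swap : ∀ i j S → volume (i ∷ j ∷ S) ≈ volume (j ∷ i ∷ S)
    volume-swap i j S = trans (*-assoc _ _ _) (trans (*-congˡ
      (+-cancelʳ (form S (pt i) (pt j) * form S (pt j) (pt i)) _ _ (begin-equality
        (1# + b) * (1# + form (j ∷ S) (pt i) (pt i)) + cᵢⱼ * cⱼᵢ  ≈⟨ expand i j ⟩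
        (1# + b) * (1# + a)                                      ≈⟨ *-comm _ _ ⟩
        (1# + a) * (1# + b)                                      ≈⟨ expand j i ⟨
        (1# + a) * (1# + form (i ∷ S) (pt j) (pt j)) + cⱼᵢ * cᵢⱼ  ≈⟨ +-congˡ (*-comm _ _) ⟩
        (1# + a) * (1# + form (i ∷ S) (pt j) (pt j)) + cᵢⱼ * cⱼᵢ  ∎))) (sym (*-assoc _ _ _)))
      where
      a = form S (pt i) (pt i)
      b = form S (pt j) (pt j)
      cᵢⱼ = form S (pt i) (pt j)
      cⱼᵢ = form S (pt j) (pt i)
      expand : ∀ i j → (1# + form S (pt j) (pt j)) * (1# + form (j ∷ S) (pt i) (pt i))
                         + form S (pt i) (pt j) * form S (pt j) (pt i)
                       ≈ (1# + form S (pt j) (pt j)) * (1# + form S (pt i) (pt i))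
      expand i j = begin-equality
        (1# + g) * (1# + G′ y y) + G y x * G x y               ≈⟨ +-congˡ (*-congʳ (tilt-* y)) ⟨
        (1# + g) * (1# + G′ y y) + (t * (1# + g)) * G x y      ≈⟨ solve 5 (λ k o h t c → k :* (o :+ h) :+ (t :* k) :* c
                                                                    := k :* (o :+ (h :+ t :* c))) refl _ _ _ _ _ ⟩
        (1# + g) * (1# + (G′ y y + t * G x y))                 ≈⟨ *-congˡ (+-congˡ (form-update j S y y)) ⟩
        (1# + g) * (1# + G y y)                                ∎
        where
        open Step j S (form-nonNeg S (pt j))
        y = pt i
        t = tilt G x y

    volume-↭ : ∀ {S T} → S ↭ T → volume S ≈ volume T
    volume-↭ ↭.refl                = refl
    volume-↭ (prep x p)            = volume-prep x p (volume-↭ p)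
    volume-↭ (swap {ys = T} x y p) = trans
      (volume-prep x (prep y p) (volume-prep y p (volume-↭ p))) (volume-swap x y T)
    volume-↭ (↭.trans p q)         = trans (volume-↭ p) (volume-↭ q)

    volume-positive : ∀ S → Positive (volume S)
    volume-positive []      = 1≰0
    volume-positive (j ∷ S) = *-pos (volume-positive S) (1≤⇒positive (x≤x+y (form-nonNeg S (pt j))))

    length≤sum-frame : ∀ {f : I → Carrier} → (∀ l → 0# ≤ f (e l)) → ∀ S → All (λ j → 1# ≤ f (pt j)) S →
                       fromℕ (length S) ≤ sum (λ r → f (frame S r))
    length≤sum-frame {f} 0≤f []      []         = sum-nonNeg 0≤f
    length≤sum-frame {f} 0≤f (j ∷ S) (1≤ ∷ all) = +-mono-≤ 1≤ (length≤sum-frame {f} 0≤f S all)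

    -- Otherwise each of the more than 2m entries adds at least 1 to twice the trace, which equals
    -- 2m; the vectors `e` add nothing negative.
    small-leverage : ∀ S → m ℕ.+ m ℕ.< length S →
                     ∃[ j ] j ∈ S × form S (pt j) (pt j) + form S (pt j) (pt j) ≤ 1#
    small-leverage S 2m< with any? (λ j → form S (pt j) (pt j) + form S (pt j) (pt j) ≤? 1#) S
    ... | yes some = find some
    ... | no  none = ⊥-elim (ℕ.<⇒≱ 2m< (fromℕ-cancel-≤ (length S) (m ℕ.+ m) (begin
      fromℕ (length S)
        ≤⟨ length≤sum-frame {λ u → form S u u + form S u u}
             (λ l → +-nonNeg (form-nonNeg S (e l)) (form-nonNeg S (e l))) S
             (All.map ≰⇒≥ (¬Any⇒All¬ S none)) ⟩
      sum (λ r → form S (frame S r) (frame S r) + form S (frame S r) (frame S r))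
        ≈⟨ ∑-distrib-+ (λ r → form S (frame S r) (frame S r)) _ ⟩
      sum (λ r → form S (frame S r) (frame S r)) + sum (λ r → form S (frame S r) (frame S r))
        ≈⟨ +-cong (trace S) (trace S) ⟩
      fromℕ m + fromℕ m
        ≈⟨ fromℕ-+ m m ⟨
      fromℕ (m ℕ.+ m) ∎)))

    -- Insertion turns g into h = g / (1 + g), so 2h ≤ 1 means 2g ≤ 1 + g.
    leverage-≤1 : ∀ j S → form (j ∷ S) (pt j) (pt j) + form (j ∷ S) (pt j) (pt j) ≤ 1# → form S (pt j) (pt j) ≤ 1#
    leverage-≤1 j S 2h≤1 = +-cancelʳ-≤ g (begin
      g + g                                  ≈⟨ +-cong (tilt-* x) (tilt-* x) ⟨
      t * (1# + g) + t * (1# + g)            ≈⟨ distribʳ (1# + g) t t ⟨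
      (t + t) * (1# + g)                     ≈⟨ *-congʳ (+-cong (form-new x) (form-new x)) ⟨
      (G′ x x + G′ x x) * (1# + g)           ≤⟨ *-monoʳ-≤ (≰⇒≥ 1+g>0) 2h≤1 ⟩
      1# * (1# + g)                          ≈⟨ *-identityˡ _ ⟩
      1# + g                                 ∎)
      where
      open Step j S (form-nonNeg S (pt j))
      t = tilt G x x

    -- Exchange argument: add j, then remove an element of leverage at most 1/2.
    maximal⇒form-≤1 : ∀ S → length S ≡ m ℕ.+ m →
                      (∀ T → length T ≡ m ℕ.+ m → volume T ≤ volume S) →
                      ∀ j → form S (pt j) (pt j) ≤ 1#
    maximal⇒form-≤1 S |S|≡2m max j =
      -- With j there are 2m + 1 entries, just above the threshold. The entry i may be j itself.
      let i , i∈ , 2h≤1    = small-leverage (j ∷ S) (s≤s (ℕ.≤-reflexive (≡.sym |S|≡2m)))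
          ys , zs , eq     = ∈-∃++ i∈
          p                = ↭.trans (↭-reflexive eq) (shift i ys zs)
          T                = ys ++ zs
          |T|≡2m           = ≡.trans (≡.sym (ℕ.suc-injective (↭-length p))) |S|≡2m
          h≈h              = form-↭ p (pt i) (pt i)
          hᵢ≤1             = leverage-≤1 i T (≤-respˡ-≈ (+-cong h≈h h≈h) 2h≤1)
      -- The volume of `j ∷ S` is factored twice, once with j and once with i inserted last;
      -- `volume T` is at most `volume S`, so that factor cancels.
      in ≤-trans (+-cancelˡ-≤ 1# (*-cancelʳ-≤ (volume-positive S) (begin
        (1# + form S (pt j) (pt j)) * volume S  ≈⟨ *-comm _ _ ⟩
        volume (j ∷ S)                          ≈⟨ volume-↭ p ⟩
        volume T * (1# + form T (pt i) (pt i))  ≤⟨ *-monoʳ-≤ (+-nonNeg 0≤1 (form-nonNeg T (pt i))) (max T |T|≡2m) ⟩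
        volume S * (1# + form T (pt i) (pt i))  ≈⟨ *-comm _ _ ⟩
        (1# + form T (pt i) (pt i)) * volume S  ∎))) hᵢ≤1

-- Elimination and the factorisation.

module Spanning {ℓ : Level} (ℝ : CompleteOrderedField ℓ) where
  open RealLinearAlgebra ℝ hiding (zero; sum)
  open OrderedFieldProperties ℝ
  open OrderedFieldLemmas ℝ
  open Sums ℝ
  open ≤-Reasoning

  δ : ∀ {n} → Fin n → Fin n → Carrier
  δ zero    zero    = 1#
  δ zero    (suc j) = 0#
  δ (suc i) zero    = 0#
  δ (suc i) (suc j) = δ i j

  δ-diagonal : ∀ {n} (i : Fin n) → δ i i ≈ 1#
  δ-diagonal zero    = refl
  δ-diagonal (suc i) = δ-diagonal i

  sum-δ : ∀ {n} (i : Fin n) (f : Fin n → Carrier) → sum (λ j → δ i j * f j) ≈ f i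
  sum-δ zero    f = trans (+-cong (*-identityˡ _) (sum-zero (λ j → zeroˡ (f (suc j))))) (+-identityʳ _)
  sum-δ (suc i) f = trans (+-cong (zeroˡ _) (sum-δ i (λ j → f (suc j)))) (+-identityˡ _)

  sum-δʳ : ∀ {n} (i : Fin n) (f : Fin n → Carrier) → sum (λ j → f j * δ i j) ≈ f i
  sum-δʳ i f = trans (sum-cong-≋ (λ j → *-comm (f j) (δ i j))) (sum-δ i f)

  SpannedBy : ∀ {k d m} (X : Fin d → Vector Carrier k) (σ : Fin m → Fin d) (c : Fin d → Vector Carrier m) → Set ℓ
  SpannedBy X σ c = ∀ j i → X j i ≈ sum (λ l → c j l * X (σ l) i)

  -- Gaussian elimination: each of the k coordinates yields at most one pivot column.
  spanning-subset : ∀ {k d} (X : Fin d → Vector Carrier k) →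
                    ∃[ m ] m ℕ.≤ k × Σ (Fin m → Fin d) λ σ → ∃[ c ] SpannedBy X σ c
  spanning-subset {zero}  X = 0 , z≤n , (λ ()) , (λ _ ()) , λ _ ()
  spanning-subset {suc k} {d} X with Fin.any? (λ j → ¬? (X j zero ≟ 0#))
  ... | no none =
    let m , m≤k , σ , c , spans = spanning-subset (λ j i → X j (suc i))
    in m , ℕ.m≤n⇒m≤1+n m≤k , σ , c , λ where
      j zero    → trans (X₀≈0 j) (sym (sum-zero (λ l → trans (*-congˡ (X₀≈0 (σ l))) (zeroʳ _))))
      j (suc i) → spans j i
    where
    X₀≈0 : ∀ j → X j zero ≈ 0#
    X₀≈0 j = decidable-stable (X j zero ≟ 0#) (λ X≉0 → none (j , X≉0))
  ... | yes (p , Xₚ≉0) =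
    let m , m≤k , σ , c , spans = spanning-subset (λ j i → Y j (suc i))
    in suc m , s≤s m≤k , extend σ , coefficients σ c , λ j i →
      combine σ c j i (λ where
        zero    → trans (Y₀≈0 j) (sym (sum-zero (λ l → trans (*-congˡ (Y₀≈0 (σ l))) (zeroʳ _))))
        (suc i) → spans j i)
    where
    q : Fin d → Carrier
    q j = X j zero * X p zero ⁻¹
    Y : Fin d → Vector Carrier (suc k)
    Y j i = X j i - q j * X p i
    Y+q*Xₚ≈X : ∀ j i → Y j i + X p i * q j ≈ X j i
    Y+q*Xₚ≈X j i = trans (+-congˡ (*-comm _ _)) (x-y+y≈x _ _)
    Y₀≈0 : ∀ j → Y j zero ≈ 0#
    Y₀≈0 j = trans (+-congˡ (-‿cong (begin-equality
      (X j zero * X p zero ⁻¹) * X p zero   ≈⟨ *-assoc _ _ _ ⟩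
      X j zero * (X p zero ⁻¹ * X p zero)   ≈⟨ *-congˡ (trans (*-comm _ _) (⁻¹-inverseʳ Xₚ≉0)) ⟩
      X j zero * 1#                         ≈⟨ *-identityʳ _ ⟩
      X j zero                              ∎))) (-‿inverseʳ _)
    extend : ∀ {m} → (Fin m → Fin d) → Fin (suc m) → Fin d
    extend σ zero    = p
    extend σ (suc l) = σ l
    -- Substituting Y = X - q Xₚ into the relation Yⱼ = ∑ cⱼₗ Y_σₗ leaves qⱼ - ∑ cⱼₗ q_σₗ as the
    -- coefficient of the pivot Xₚ.
    coefficients : ∀ {m} → (Fin m → Fin d) → (Fin d → Vector Carrier m) → Fin d → Vector Carrier (suc m)
    coefficients σ c j zero    = q j - sum (λ l → c j l * q (σ l))
    coefficients σ c j (suc l) = c j l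
    combine : ∀ {m} (σ : Fin m → Fin d) (c : Fin d → Vector Carrier m) j i →
              (∀ i → Y j i ≈ sum (λ l → c j l * Y (σ l) i)) →
              X j i ≈ sum (λ l → coefficients σ c j l * X (extend σ l) i)
    combine σ c j i spans = sym (begin-equality
      (q j - t) * b + sum (λ l → c j l * X (σ l) i)
        ≈⟨ +-congˡ (sum-+-* (λ l → trans (rearrange _ _ _ _) (*-congˡ (Y+q*Xₚ≈X (σ l) i)))) ⟨
      (q j - t) * b + (sum (λ l → c j l * Y (σ l) i) + b * t)
        ≈⟨ +-congˡ (+-congʳ (spans i)) ⟨
      (q j - t) * b + (Y j i + b * t)
        ≈⟨ solve 4 (λ a b y t → a :* b :+ (y :+ b :* t) := y :+ b :* (a :+ t)) refl (q j - t) b (Y j i) t ⟩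
      Y j i + b * ((q j - t) + t)
        ≈⟨ +-congˡ (*-congˡ (x-y+y≈x (q j) t)) ⟩
      Y j i + b * q j
        ≈⟨ Y+q*Xₚ≈X j i ⟩
      X j i ∎)
      where
      b = X p i
      t = sum (λ l → c j l * q (σ l))
      rearrange : ∀ c y b q → c * y + b * (c * q) ≈ c * (y + b * q)
      rearrange = solve 4 (λ c y b q → c :* y :+ b :* (c :* q) := c :* (y :+ b :* q)) refl

  record Decomposition {n d} (a : Fin d → Vector Carrier n) (k : ℕ) : Set ℓ where
    field
      size           : ℕ
      size≤          : size ℕ.≤ k
      left           : Matrix n size
      right          : Matrix size d
      product        : ∀ j i → a j i ≈ sum (λ r → left i r * right r j)
      left-columns   : ∀ r → ∃[ j ] (∀ i → left i r ≈ a j i)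
      right-columns  : ∀ j → sum (λ r → right r j * right r j) ≤ 1#

  -- In coordinates over σ, `φ i` recovers the i-th entry of a vector. That the frame reproduces
  -- `φ i` is the factorisation itself, and Parseval turns the bound on a column of `right` into the
  -- bound on `form S (c j) (c j)`.
  decompose-spanned : ∀ {n d m} (a : Fin (suc d) → Vector Carrier n) σ c → SpannedBy {m = m} a σ c →
                      Decomposition a (3 ℕ.* m)
  decompose-spanned {n} {d} {m} a σ c spans = record
    { size          = length S ℕ.+ m
    ; size≤         = ℕ.≤-reflexive size≡
    ; left          = λ i r → φ i (frame S r)
    ; right         = λ r j → form S (c j) (frame S r)
    ; product       = λ j i → begin-equality
        a j i                                                       ≈⟨ spans j i ⟩
        φ i (c j)                                                   ≈⟨ reproduced {φ i} (φ-reproduced i) S (c j) ⟨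
        sum (λ r → form S (c j) (frame S r) * φ i (frame S r))
          ≈⟨ sum-cong-≋ (λ r → *-comm (form S (c j) (frame S r)) (φ i (frame S r))) ⟩
        sum (λ r → φ i (frame S r) * form S (c j) (frame S r))      ∎
    ; left-columns  = columns S
    ; right-columns = λ j → ≤-respˡ-≈ (sym (norm-form S (parseval S) (c j)))
        (maximal⇒form-≤1 S (proj₁ (proj₂ best)) (proj₂ (proj₂ best)) j)
    }
    where
    dot : Vector Carrier m → Vector Carrier m → Carrier
    dot u v = sum (λ l → u l * v l)
    φ : Fin n → Vector Carrier m → Carrier
    φ i u = sum (λ l → u l * a (σ l) i)
    open Frames ℝ c δ dot
    open Orthonormal
      (λ u v → sum-cong-≋ (λ l → *-comm (u l) (v l)))
      (λ v u → sum-cong-≋ (λ l → *-cong (sum-δʳ l u) (sum-δ l v)))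
      (λ l → trans (sum-δ l (δ l)) (δ-diagonal l))
    φ-reproduced : ∀ i → Reproduced [] (φ i)
    φ-reproduced i u = sum-cong-≋ (λ l → *-cong (sum-δʳ l u) (sum-δ l (λ l → a (σ l) i)))
    best = maximumList (m ℕ.+ m) volume
    S = proj₁ best
    size≡ : length S ℕ.+ m ≡ 3 ℕ.* m
    size≡ = ≡.trans (≡.cong (ℕ._+ m) (proj₁ (proj₂ best)))
      (≡.trans (ℕ.+-assoc m m m) (≡.cong (λ x → m ℕ.+ (m ℕ.+ x)) (≡.sym (ℕ.+-identityʳ m))))
    columns : ∀ S r → ∃[ j ] (∀ i → φ i (frame S r) ≈ a j i)
    columns []      r       = σ r , λ i → sum-δ r (λ l → a (σ l) i)
    columns (j ∷ S) zero    = j , λ i → sym (spans j i)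
    columns (j ∷ S) (suc r) = columns S r

  -- Elimination runs on the coordinate vectors over B, which have only k entries; the relations
  -- found there are carried back through B.
  decompose : ∀ {n k d} (B : Matrix n k) (a : Fin d → Vector Carrier n) → (∀ j → a j ∈ColumnSpace B) →
              Decomposition a (3 ℕ.* k)
  -- Maximising over lists of columns needs at least one column.
  decompose {d = zero}  B a a∈B = record
    { size = 0 ; size≤ = z≤n ; left = λ _ () ; right = λ ()
    ; product = λ () ; left-columns = λ () ; right-columns = λ () }
  decompose {k = k} {d = suc d} B a a∈B =
    let m , m≤k , σ , c , spans = spanning-subset X
        D = decompose-spanned a σ c (λ j i → begin-equality
          a j i
            ≈⟨ proj₂ (a∈B j) i ⟩
          sum (λ κ → B i κ * X j κ)
            ≈⟨ sum-cong-≋ (λ κ → trans (*-congˡ (spans j κ)) (*-distribˡ-sum (B i κ) (λ l → c j l * X (σ l) κ))) ⟩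
          sum (λ κ → sum (λ l → B i κ * (c j l * X (σ l) κ)))
            ≈⟨ ∑-comm (λ κ l → B i κ * (c j l * X (σ l) κ)) ⟩
          sum (λ l → sum (λ κ → B i κ * (c j l * X (σ l) κ)))
            ≈⟨ sum-cong-≋ (λ l → sum-cong-≋ (λ κ →
                 solve 3 (λ b c x → b :* (c :* x) := c :* (b :* x)) refl (B i κ) (c j l) (X (σ l) κ))) ⟩
          sum (λ l → sum (λ κ → c j l * (B i κ * X (σ l) κ)))
            ≈⟨ sum-cong-≋ (λ l → *-distribˡ-sum (c j l) (λ κ → B i κ * X (σ l) κ)) ⟨
          sum (λ l → c j l * sum (λ κ → B i κ * X (σ l) κ))
            ≈⟨ sum-cong-≋ (λ l → *-congˡ (proj₂ (a∈B (σ l)) i)) ⟨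
          sum (λ l → c j l * a (σ l) i) ∎)
    in record
      { Decomposition D
      ; size≤ = ℕ.≤-trans (Decomposition.size≤ D) (ℕ.*-monoʳ-≤ 3 m≤k)
      }
    where
    X : Fin (suc d) → Vector Carrier k
    X j = proj₁ (a∈B j)

-- Absolute values and p-norms.

module Norms {ℓ : Level} (ℝ : CompleteOrderedField ℓ) where
  open RealLinearAlgebra ℝ hiding (zero; sum)
  open OrderedFieldProperties ℝ
  open OrderedFieldLemmas ℝ
  open RealPowers ℝ
  open Sums ℝ
  open RingProperties ring using (-‿distribʳ-*; -‿distribˡ-*; -‿involutive; -0#≈0#)
  open NaturalChoice.MaxOperator (Max.maxOperator totalOrder) using (x≤y⇒x⊔y≈y; x≥y⇒x⊔y≈x)
  open ≤-Reasoning

  0≤x⇒-x≤x : ∀ {x} → 0# ≤ x → - x ≤ x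
  0≤x⇒-x≤x {x} 0≤x = ≤-trans (≤-respˡ-≈ (+-identityˡ _) (≤-respʳ-≈ (-‿inverseʳ x) (+-monoʳ-≤ (- x) 0≤x))) 0≤x

  x≤0⇒x≤-x : ∀ {x} → x ≤ 0# → x ≤ - x
  x≤0⇒x≤-x {x} x≤0 = ≤-trans x≤0 (≤-respʳ-≈ (+-identityˡ _) (x≤y⇒0≤y-x x≤0))

  ∣x∣≈x : ∀ {x} → 0# ≤ x → ∣ x ∣ ≈ x
  ∣x∣≈x 0≤x = x≥y⇒x⊔y≈x (0≤x⇒-x≤x 0≤x)

  ∣x∣≈-x : ∀ {x} → x ≤ 0# → ∣ x ∣ ≈ - x
  ∣x∣≈-x x≤0 = x≤y⇒x⊔y≈y (x≤0⇒x≤-x x≤0)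

  ∣∣-nonNeg : ∀ x → 0# ≤ ∣ x ∣
  ∣∣-nonNeg x with total 0# x
  ... | inj₁ 0≤x = ≤-respʳ-≈ (sym (∣x∣≈x 0≤x)) 0≤x
  ... | inj₂ x≤0 = ≤-respʳ-≈ (trans (+-identityˡ _) (sym (∣x∣≈-x x≤0))) (x≤y⇒0≤y-x x≤0)

  ∣∣-cong : ∀ {x y} → x ≈ y → ∣ x ∣ ≈ ∣ y ∣
  ∣∣-cong {x} {y} x≈y with total 0# x
  ... | inj₁ 0≤x = trans (∣x∣≈x 0≤x) (trans x≈y (sym (∣x∣≈x (≤-respʳ-≈ x≈y 0≤x))))
  ... | inj₂ x≤0 = trans (∣x∣≈-x x≤0) (trans (-‿cong x≈y) (sym (∣x∣≈-x (≤-respˡ-≈ x≈y x≤0))))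

  ∣∣-*-homo : ∀ {c} → 0# ≤ c → ∀ x → ∣ c * x ∣ ≈ c * ∣ x ∣
  ∣∣-*-homo {c} 0≤c x with total 0# x
  ... | inj₁ 0≤x = trans (∣x∣≈x (*-nonNeg 0≤c 0≤x)) (*-congˡ (sym (∣x∣≈x 0≤x)))
  ... | inj₂ x≤0 = trans (∣x∣≈-x (≤-respʳ-≈ (zeroʳ c) (*-monoˡ-≤ 0≤c x≤0)))
                  (trans (-‿distribʳ-* c x) (*-congˡ (sym (∣x∣≈-x x≤0))))

  ∣x∣*∣x∣≈x*x : ∀ x → ∣ x ∣ * ∣ x ∣ ≈ x * x
  ∣x∣*∣x∣≈x*x x with total 0# x
  ... | inj₁ 0≤x = *-cong (∣x∣≈x 0≤x) (∣x∣≈x 0≤x)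
  ... | inj₂ x≤0 = trans (*-cong (∣x∣≈-x x≤0) (∣x∣≈-x x≤0))
    (trans (sym (-‿distribˡ-* x (- x))) (trans (-‿cong (sym (-‿distribʳ-* x x))) (-‿involutive _)))

  ∣x∣≈0⇒x≈0 : ∀ {x} → ∣ x ∣ ≈ 0# → x ≈ 0#
  ∣x∣≈0⇒x≈0 {x} ∣x∣≈0 with total 0# x
  ... | inj₁ 0≤x = trans (sym (∣x∣≈x 0≤x)) ∣x∣≈0
  ... | inj₂ x≤0 = trans (sym (-‿involutive x)) (trans (-‿cong (trans (sym (∣x∣≈-x x≤0)) ∣x∣≈0)) -0#≈0#)

  module PNorm {p : Carrier} (p>0 : Positive p) where
    0≤p : 0# ≤ p
    0≤p = positive⇒nonNeg p>0
    0≤p⁻¹ : 0# ≤ p ⁻¹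
    0≤p⁻¹ = positive⇒nonNeg (⁻¹-positive p>0)

    powerSum : ∀ {n} → Vector Carrier n → Carrier
    powerSum v = sum (λ i → ∣ v i ∣ ^ʳ p)

    ∣∣^ʳ-nonNeg : ∀ x → 0# ≤ ∣ x ∣ ^ʳ p
    ∣∣^ʳ-nonNeg x = ^ʳ-nonNeg (∣∣-nonNeg x) 0≤p

    powerSum-nonNeg : ∀ {n} (v : Vector Carrier n) → 0# ≤ powerSum v
    powerSum-nonNeg v = sum-nonNeg (λ i → ∣∣^ʳ-nonNeg (v i))

    powerSum-cong : ∀ {n} {v w : Vector Carrier n} → (∀ i → v i ≈ w i) → powerSum v ≈ powerSum w
    powerSum-cong {v = v} v≈w = sum-cong-≋ (λ i → ^ʳ-cong 0≤p (∣∣-nonNeg (v i)) (∣∣-cong (v≈w i)))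

    powerSum-* : ∀ {n c} → 0# ≤ c → (v : Vector Carrier n) → powerSum (λ i → c * v i) ≈ c ^ʳ p * powerSum v
    powerSum-* {c = c} 0≤c v = trans
      (sum-cong-≋ (λ i → trans
        (^ʳ-cong 0≤p (∣∣-nonNeg (c * v i)) (∣∣-*-homo 0≤c (v i)))
        (^ʳ-distrib-* 0≤p 0≤c (∣∣-nonNeg (v i)))))
      (sym (*-distribˡ-sum (c ^ʳ p) (λ i → ∣ v i ∣ ^ʳ p)))

    norm-nonNeg : ∀ {n} (v : Vector Carrier n) → 0# ≤ ‖ v ‖[ p ]
    norm-nonNeg v = ^ʳ-nonNeg (powerSum-nonNeg v) 0≤p⁻¹

    norm^ʳp : ∀ {n} (v : Vector Carrier n) → ‖ v ‖[ p ] ^ʳ p ≈ powerSum v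
    norm^ʳp v = ^ʳ-inverse 0≤p⁻¹ 0≤p (x⁻¹*x≈1 p>0) (powerSum-nonNeg v)

    powerSum≤⇒norm≤ : ∀ {n c} (v : Vector Carrier n) → 0# ≤ c → powerSum v ≤ c ^ʳ p → ‖ v ‖[ p ] ≤ c
    powerSum≤⇒norm≤ v 0≤c le = ≤-respʳ-≈ (^ʳ-inverse 0≤p 0≤p⁻¹ (x*x⁻¹≈1 p>0) 0≤c)
      (^ʳ-mono-≤ 0≤p⁻¹ (powerSum-nonNeg v) le)

    norm-cong : ∀ {n} {v w : Vector Carrier n} → (∀ i → v i ≈ w i) → ‖ v ‖[ p ] ≈ ‖ w ‖[ p ]
    norm-cong {v = v} v≈w = ^ʳ-cong 0≤p⁻¹ (powerSum-nonNeg v) (powerSum-cong v≈w)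

    norm≈0⇒≈0 : ∀ {n} {v : Vector Carrier n} → ‖ v ‖[ p ] ≈ 0# → ∀ i → v i ≈ 0#
    norm≈0⇒≈0 {v = v} norm≈0 i = ∣x∣≈0⇒x≈0 (begin-equality
      ∣ v i ∣                      ≈⟨ ^ʳ-inverse 0≤p 0≤p⁻¹ (x*x⁻¹≈1 p>0) (∣∣-nonNeg (v i)) ⟨
      (∣ v i ∣ ^ʳ p) ^ʳ (p ⁻¹)      ≈⟨ ^ʳ-cong 0≤p⁻¹ (∣∣^ʳ-nonNeg (v i)) (antisym ∣vᵢ∣^p≤0 (∣∣^ʳ-nonNeg (v i))) ⟩
      0# ^ʳ (p ⁻¹)                 ≈⟨ 0^ʳ 0≤p⁻¹ ⟩
      0#                           ∎)
      where
      ∣vᵢ∣^p≤0 : ∣ v i ∣ ^ʳ p ≤ 0#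
      ∣vᵢ∣^p≤0 = begin
        ∣ v i ∣ ^ʳ p      ≤⟨ term≤sum (λ i → ∣∣^ʳ-nonNeg (v i)) i ⟩
        powerSum v        ≈⟨ norm^ʳp v ⟨
        ‖ v ‖[ p ] ^ʳ p   ≈⟨ ^ʳ-cong 0≤p (norm-nonNeg v) norm≈0 ⟩
        0# ^ʳ p           ≈⟨ 0^ʳ 0≤p ⟩
        0#                ∎

    -- For a zero vector the inverse has an unspecified value, but it multiplies entries that
    -- vanish, so the result is zero again.
    normalise : ∀ {n} → Vector Carrier n → Vector Carrier n
    normalise v i = ‖ v ‖[ p ] ⁻¹ * v i

    norm*normalise : ∀ {n} (v : Vector Carrier n) i → v i ≈ ‖ v ‖[ p ] * normalise v i
    norm*normalise v i with ‖ v ‖[ p ] ≟ 0#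
    ... | yes ν≈0 = trans (norm≈0⇒≈0 ν≈0 i) (sym (trans (*-congʳ ν≈0) (zeroˡ _)))
    ... | no  ν≉0 = sym (trans (sym (*-assoc _ _ _)) (trans (*-congʳ (⁻¹-inverseʳ ν≉0)) (*-identityˡ _)))

    norm-normalise≤1 : ∀ {n} (v : Vector Carrier n) → ‖ normalise v ‖[ p ] ≤ 1#
    norm-normalise≤1 v = powerSum≤⇒norm≤ (normalise v) 0≤1 (≤-respʳ-≈ (sym (1^ʳ 0≤p)) powerSum≤1)
      where
      ν = ‖ v ‖[ p ]
      powerSum≤1 : powerSum (normalise v) ≤ 1#
      powerSum≤1 with ν ≤? 0#
      ... | yes ν≤0 = ≤-trans (≤-reflexive (sum-zero (λ i → trans
              (^ʳ-cong 0≤p (∣∣-nonNeg (normalise v i)) (trans (∣∣-cong (vanish i)) (∣x∣≈x ≤-refl))) (0^ʳ 0≤p)))) 0≤1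
        where
        vanish : ∀ i → normalise v i ≈ 0#
        vanish i = trans (*-congˡ (norm≈0⇒≈0 (antisym ν≤0 (norm-nonNeg v)) i)) (zeroʳ _)
      ... | no  ν>0 = ≤-reflexive (begin-equality
        powerSum (normalise v)     ≈⟨ powerSum-* 0≤ν⁻¹ v ⟩
        (ν ⁻¹) ^ʳ p * powerSum v     ≈⟨ *-congˡ (norm^ʳp v) ⟨
        (ν ⁻¹) ^ʳ p * ν ^ʳ p         ≈⟨ ^ʳ-distrib-* 0≤p 0≤ν⁻¹ (norm-nonNeg v) ⟨
        (ν ⁻¹ * ν) ^ʳ p            ≈⟨ ^ʳ-cong 0≤p (*-nonNeg 0≤ν⁻¹ (norm-nonNeg v)) (x⁻¹*x≈1 ν>0) ⟩
        1# ^ʳ p                    ≈⟨ 1^ʳ 0≤p ⟩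
        1#                         ∎)
        where
        0≤ν⁻¹ : 0# ≤ ν ⁻¹
        0≤ν⁻¹ = positive⇒nonNeg (⁻¹-positive ν>0)

  2>0 : Positive 2#
  2>0 = 1≤⇒positive (x≤x+y 0≤1)

  norm₂-*≤ : ∀ {n c} → 0# ≤ c → (v : Vector Carrier n) → sum (λ i → v i * v i) ≤ 1# →
             ‖ (λ i → c * v i) ‖[ 2# ] ≤ c
  norm₂-*≤ {c = c} 0≤c v ∑v²≤1 = powerSum≤⇒norm≤ (λ i → c * v i) 0≤c (begin
    powerSum (λ i → c * v i)             ≈⟨ powerSum-* 0≤c v ⟩
    c ^ʳ 2# * powerSum v
      ≈⟨ *-congˡ (sum-cong-≋ (λ i → trans (x^ʳ2≈x*x (∣∣-nonNeg (v i))) (∣x∣*∣x∣≈x*x (v i)))) ⟩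
    c ^ʳ 2# * sum (λ i → v i * v i)      ≤⟨ *-monoˡ-≤ (^ʳ-nonNeg 0≤c 0≤2) ∑v²≤1 ⟩
    c ^ʳ 2# * 1#                         ≈⟨ *-identityʳ _ ⟩
    c ^ʳ 2#                              ∎)
    where open PNorm 2>0

theorem1p13 : ∀ {ℓ} (ℝ : CompleteOrderedField ℓ) →
    let open RealLinearAlgebra ℝ in
    Σ ℕ λ C → Σ Carrier λ K →
    ∀ (n d k : ℕ) (L : Matrix n d) → HasRank L k →
    ∀ (p : Carrier) → 1# ≤ p →
    Σ ℕ λ s → (s ℕ.≤ C ℕ.* (k ℕ.* loglog k)) ×
    Σ (Matrix n s) λ U → Σ (Matrix s d) λ Vᵀ →
    (L ≈ᴹ (U · Vᵀ)) ×
    (∀ i → ‖ column U i ‖[ p ] ≤ 1#) ×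
    (∀ j → ‖ column Vᵀ j ‖[ 2# ] ≤ K * ‖ column L j ‖[ p ])
theorem1p13 ℝ = 3 , 1# , λ n d k L (B , _ , colL⇔colB) p 1≤p →
  let open PNorm (1≤⇒positive 1≤p)
      ν : Fin d → Carrier
      ν j = ‖ column L j ‖[ p ]
      L∈B : ∀ j → column L j ∈ColumnSpace B
      L∈B j = Equivalence.to (colL⇔colB (column L j)) (δ j , λ i → sym (sum-δʳ j (L i)))
      a∈B : ∀ j → normalise (column L j) ∈ColumnSpace B
      a∈B j = let y , L≈By = L∈B j in
        (λ l → ν j ⁻¹ * y l) , λ i → begin-equality
          ν j ⁻¹ * L i j                       ≈⟨ *-congˡ (L≈By i) ⟩
          ν j ⁻¹ * sum (λ l → B i l * y l)     ≈⟨ *-distribˡ-sum (ν j ⁻¹) (λ l → B i l * y l) ⟩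
          sum (λ l → ν j ⁻¹ * (B i l * y l))   ≈⟨ sum-cong-≋ (λ l → x∙yz≈y∙xz (ν j ⁻¹) (B i l) (y l)) ⟩
          sum (λ l → B i l * (ν j ⁻¹ * y l))   ∎
      open Decomposition (decompose B (λ j → normalise (column L j)) a∈B)
  in size
   -- `loglog k` is at least 1 by definition, so 3k already meets the bound.
   , ℕ.≤-trans size≤ (ℕ.*-monoʳ-≤ 3
       (ℕ.≤-trans (ℕ.≤-reflexive (≡.sym (ℕ.*-identityʳ k))) (ℕ.*-monoʳ-≤ k (ℕ.m≤m⊔n 1 ⌊log₂ ⌊log₂ k ⌋ ⌋))))
   , left
   -- The norms divided out of `L` return on the right. The columns of `right` have 2-norm at most
   -- 1, which gives the constant `1#`.
   , (λ r j → ν j * right r j)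
   , (λ i j → begin-equality
        L i j                                        ≈⟨ norm*normalise (column L j) i ⟩
        ν j * normalise (column L j) i               ≈⟨ *-congˡ (product j i) ⟩
        ν j * sum (λ r → left i r * right r j)       ≈⟨ *-distribˡ-sum (ν j) (λ r → left i r * right r j) ⟩
        sum (λ r → ν j * (left i r * right r j))     ≈⟨ sum-cong-≋ (λ r → x∙yz≈y∙xz (ν j) (left i r) (right r j)) ⟩
        sum (λ r → left i r * (ν j * right r j))     ∎)
   , (λ r → let j , left≈ = left-columns r in
        ≤-respˡ-≈ (sym (norm-cong left≈)) (norm-normalise≤1 (column L j)))
   , (λ j → ≤-respʳ-≈ (sym (*-identityˡ (ν j)))
       (norm₂-*≤ (norm-nonNeg (column L j)) (λ r → right r j) (right-columns j)))
  where
  open RealLinearAlgebra ℝ hiding (zero; sum)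
  open OrderedFieldProperties ℝ using (≤-respˡ-≈; ≤-respʳ-≈)
  open OrderedFieldLemmas ℝ
  open Sums ℝ
  open Spanning ℝ
  open Norms ℝ
  open CommutativeSemigroupProperties *-commutativeSemigroup using (x∙yz≈y∙xz)
  open ≤-Reasoning
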